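{- Let $b=b(n)\ge 1$ be an integer-valued function that is subpolynomial in $n$. Then, as $n\to\infty$, $$\tau(\mathcal{C}_n,b)=(1+o(1))\log_{b+1}(n),$$ where $\mathcal{C}_n$ is the hypergraph with vertex set $E(K_n)$ whose hyperedges are the edge sets of all spanning trees of $K_n$.
   Context: A function $f(n)$ is subpolynomial in $n$ if $f(n)=o(n^{\varepsilon})$ for all $\varepsilon>0$. Multistage $(1:b)$ Maker-Breaker game on a hypergraph $\mathcal{H}=(\mathcal{X},\mathcal{F})$ (board $\mathcal{X}$, family of winning sets $\mathcal{F}$), $b\ge 1$ an integer: Put $\mathcal{X}_0:=\mathcal{X}$, $\mathcal{F}_0:=\mathcal{F}$. For $i\ge 1$, in Stage $i$ Maker and Breaker play on the board $\mathcal{X}_{i-1}$, alternating in turns in which Maker claims exactly one unclaimed element of $\mathcal{X}_{i-1}$ and afterwards Breaker claims up to $b$ unclaimed elements of $\mathcal{X}_{i-1}$, with Maker moving first. Once all elements of $\mathcal{X}_{i-1}$ have been distributed among the players, $\mathcal{X}_i\subseteq\mathcal{X}_{i-1}$ denotes the set of all elements claimed by Maker in Stage $i$, and $\mathcal{F}_i:=\{F\in\mathcal{F}_{i-1}: F\subseteq\mathcal{X}_i\}$. The game stops the first time no winning sets are left. The threshold parameter $\tau(\mathcal{H},b)$ is the largest number $s$ such that Maker has a strategy (against every play of Breaker) ensuring $\mathcal{F}_s\neq\varnothing$. -}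

module Defs where

open import Data.Nat using (ℕ; zero; suc; _+_; _*_; _∸_; _^_; _≤_; _<_)
open import Data.Fin using (Fin)
import Data.Fin.Properties as Fin
open import Data.Fin.Subset using (Subset; _∈_; _⊆_; _∪_; _─_; _-_; ⁅_⁆; ∣_∣; Empty; ⊤; ⊥)
open import Data.List using (List; _∷_; []; _++_; length; lookup; filter; allFin; cartesianProduct)
open import Data.List.Relation.Unary.Linked using (Linked)
open import Data.List.Relation.Unary.Unique.Propositional using (Unique)
open import Data.Product using (∃; ∃-syntax; _×_; _,_)
open import Data.Sum using (_⊎_)
open import Relation.Binary.Construct.Closure.ReflexiveTransitive using (Star)
open import Relation.Binary.PropositionalEquality using (_≡_)
open import Relation.Nullary using (¬_)

-- The board is all of Fin size; winning sets are given by a predicate on its subsets.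
record Hypergraph : Set₁ where
  field
    size    : ℕ
    Winning : Subset size → Set

module _ {m : ℕ} (b : ℕ) where

  -- An inhabitant of StageStrategy Goal U M is a (history-dependent) strategy tree
  -- for Maker in the rest of a (1 : b) stage, with Maker to move, U the set of
  -- unclaimed elements and M the set of elements Maker already owns.  Against every
  -- play of Breaker, Maker's final set satisfies Goal.
  data StageStrategy (Goal : Subset m → Set) (U M : Subset m) : Set where
    end   : Empty U → Goal M → StageStrategy Goal U M
    claim : (x : Fin m) → x ∈ U →
            ((B : Subset m) → B ⊆ U - x → ∣ B ∣ ≤ b →
              StageStrategy Goal ((U - x) ─ B) (M ∪ ⁅ x ⁆)) →
            StageStrategy Goal U M

  _∣ᶠ_ : (Subset m → Set) → Subset m → (Subset m → Set)
  (𝓕 ∣ᶠ X) F = 𝓕 F × F ⊆ X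

  -- From a stage about to be played on board X with surviving winning sets 𝓕,
  -- Maker can ensure that some winning set is left after s further stages.
  -- The goal of the current stage is a strategy for the remaining ones.
  Survives : ℕ → Subset m → (Subset m → Set) → Set
  Survives zero    X 𝓕 = ∃ 𝓕
  Survives (suc s) X 𝓕 = StageStrategy (λ X′ → Survives s X′ (𝓕 ∣ᶠ X′)) X ⊥

MakerEnsures : Hypergraph → ℕ → ℕ → Set
MakerEnsures 𝓗 b s = Survives b s ⊤ (Hypergraph.Winning 𝓗)

-- τ(𝓗, b) = s.  Stated as a relation because there may be no largest s: a winning set
-- of size at most one (as for K_1 and K_2 below) lets Maker survive forever.
IsThreshold : Hypergraph → ℕ → ℕ → Set
IsThreshold 𝓗 b s = MakerEnsures 𝓗 b s × (∀ s′ → MakerEnsures 𝓗 b s′ → s′ ≤ s)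

-- E(K_n): each edge {i , j} is listed once, as the pair with i < j.
edges : (n : ℕ) → List (Fin n × Fin n)
edges n = filter (λ (i , j) → i Fin.<? j) (cartesianProduct (allFin n) (allFin n))

EdgeSet : ℕ → Set
EdgeSet n = Subset (length (edges n))

module _ (n : ℕ) (T : EdgeSet n) where

  Adjacent : Fin n → Fin n → Set
  Adjacent u v = ∃[ e ] e ∈ T × (lookup (edges n) e ≡ (u , v) ⊎ lookup (edges n) e ≡ (v , u))

  Connected : Set
  Connected = ∀ u v → Star Adjacent u v

  -- Distinct v , w₁ , … , w_k with k ≥ 2 such that v w₁ … w_k v is a walk.
  Cycle : Set
  Cycle = ∃[ v ] ∃[ ws ] 2 ≤ length ws × Unique (v ∷ ws) × Linked Adjacent (v ∷ ws ++ v ∷ [])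

  IsSpanningTree : Set
  IsSpanningTree = Connected × ¬ Cycle

𝓒 : ℕ → Hypergraph
𝓒 n = record { size = length (edges n) ; Winning = IsSpanningTree n }

Eventually : (ℕ → Set) → Set
Eventually P = ∃[ N ] ∀ n → N ≤ n → P n

-- f(n) = o(n^(p/q)): for every constant 1/k > 0, eventually f(n) ≤ (1/k) n^(p/q),
-- with both sides multiplied by k and raised to the power q.
_≪n^_/_ : (ℕ → ℕ) → ℕ → ℕ → Set
f ≪n^ p / q = ∀ k → 0 < k → Eventually λ n → (k * f n) ^ q ≤ n ^ p

-- Rational exponents suffice, since n^ε is monotone in ε.
Subpolynomial : (ℕ → ℕ) → Set
Subpolynomial f = ∀ p q → 0 < p → 0 < q → f ≪n^ p / q

-- The real number log_β n (for β ≥ 2, n ≥ 1) is given by its comparisons with the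
-- nonnegative rationals p/q (q > 0):  p/q ≤ log_β n  iff  β^(p/q) ≤ n  iff  β^p ≤ n^q.
_/_≤log[_]_ : ℕ → ℕ → ℕ → ℕ → Set
p / q ≤log[ β ] n = β ^ p ≤ n ^ q

log[_]_≤_/_ : ℕ → ℕ → ℕ → ℕ → Set
log[ β ] n ≤ p / q = n ^ q ≤ β ^ p

-- f(n) = (1 + o(1)) log_{β(n)} n:  for every rational ε = p/q with 0 < ε < 1, eventually
-- (1 - ε) log_{β(n)} n ≤ f(n) ≤ (1 + ε) log_{β(n)} n, that is,
-- f(n) / (1 + ε) ≤ log_{β(n)} n ≤ f(n) / (1 - ε).
_≈[1+o[1]]log[_] : (ℕ → ℕ) → (ℕ → ℕ) → Set
f ≈[1+o[1]]log[ β ] = ∀ p q → 0 < p → p < q → Eventually λ n →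
  ((f n * q) / (q + p) ≤log[ β n ] n) × (log[ β n ] n ≤ (f n * q) / (q ∸ p))

{-# OPTIONS --safe #-}

-- Upper bound: a Breaker who always claims b elements leaves Maker with at most (|X| + b)/(b + 1)
-- elements of a board X, and a connected graph on n vertices has at least n/2 edges.
--
-- Lower bound: Maker keeps, for every vertex set A with 1 ≤ |A| ≤ n/2, at least k|A| edges across the
-- cut of A, where k starts at n/2 and drops by a factor of about b + 1 + 1/r per stage.  Within a stage
-- she claims the edge that decreases a potential most.  The potential is a sum over all 2ⁿ sets A of
-- (2n)^(n - |A|) θ^(r B - (r b + 1) M), where M and B count the edges across the cut already claimed by
-- Maker and Breaker; since θ^(rb) + θ^-(rb+1) ≤ 2 for θ close enough to 1, it never increases.  The
-- exponent being linear, a deficit of Maker at the cut of A would make the power of θ at least (6n)^|A|,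
-- and then the summand of A alone would exceed the initial potential, which is at most 2 (2n)ⁿ.
-- For r = 2q the factors 1 + 1/(r (b + 1)) of all stages multiply to about n^(1/r) at most.

module Submission where

open import Data.Bool using (Bool; true; false; _xor_; not; if_then_else_)
open import Data.Fin using (Fin; zero; suc)
import Data.Fin as Fin
import Data.Fin.Properties as Fin
open import Data.Fin.Subset using (Subset; Nonempty; Empty; inside; outside; _∈_; _∉_; _⊆_; _∪_; _∩_; _─_; _-_; ⁅_⁆; ∣_∣; ⊤; ⊥; ∁)
open import Data.Fin.Subset.Properties
open import Data.List using (List; []; _∷_; _++_; length; filter; allFin; cartesianProduct; map; tabulate)
import Data.List as List
open import Data.List.Properties using (map-tabulate; length-filter; length-++; length-map; length-tabulate; map-cong; map-++; map-∘)
open import Data.List.Relation.Unary.All using (All; []; _∷_)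
import Data.List.Relation.Unary.All as All
open import Data.List.Relation.Unary.AllPairs using ([]; _∷_)
open import Data.List.Relation.Unary.Linked using (Linked; []; [-]; _∷_)
open import Data.Nat hiding (∣_-_∣)
open import Data.Nat.DivMod using (m≡m%n+[m/n]*n; m%n<n; m/n*n≤m; m≥n⇒m/n>0)
open import Data.Nat.ListAction using (sum)
open import Data.Nat.ListAction.Properties using (sum-++)
open import Data.Nat.Properties
open import Algebra.Properties.CommutativeSemigroup *-commutativeSemigroup using (x∙yz≈y∙xz)
open import Data.Nat.Tactic.RingSolver using (solve-∀)
open import Data.Product using (∃-syntax; _×_; _,_; map₂; proj₁; proj₂)
import Data.Product as Product
open import Data.Sum using (_⊎_; inj₁; inj₂)
import Data.Sum as Sum
open import Data.Vec using (Vec; []; _∷_; lookup; replicate; _[_]≔_; here; there)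
open import Data.Vec.Properties using (lookup∘update; lookup∘update′; lookup-replicate; []≔-lookup; lookup⇒[]=; []=⇒lookup; lookup-map)
open import Function using (_∘_; const; id)
open import Relation.Binary.Construct.Closure.ReflexiveTransitive using (Star; ε; _◅_; _◅◅_; return; reverse; _⋆)
import Relation.Binary.Construct.Closure.ReflexiveTransitive as Star
open import Relation.Binary.PropositionalEquality hiding (J)
open import Relation.Nullary using (¬_; Dec; yes; no; does; contradiction)
open import Relation.Nullary.Decidable using (map′; _→-dec_; _×-dec_; _⊎-dec_; ¬?; decidable-stable)
open import Relation.Unary using (Decidable)
open import Defs

-- A potential strategy for one stage

-- The obstacle is that losses compound. There are about log n / log (b + 1) stages, so a constant
-- factor lost in each of them, beyond the unavoidable b + 1, would cost a fixed power of n when b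
-- is bounded. Hence the exponents r and r b + 1 in the potential: they register any lag of Maker
-- behind the share r / (r (b + 1) + 1), and r is free to be large. The price is that θ - 1 is only
-- 1 / (r b + 1)², so the exponent must reach the order of (r b + 1)² log n per vertex of A before a
-- deficit contradicts the potential. This is an additive loss per stage, and it is harmless because
-- b is subpolynomial. Everything is done in ℕ: θ is a fraction P / N, and inequalities are
-- multiplied by common powers of P and N. A second obstacle is that τ has to be exhibited. The game
-- is therefore shown to be decidable, after the families of spanning trees have been replaced by
-- connectivity of the board, and τ is found by a bounded search.

argmax : ∀ {m} (f : Fin m → ℕ) (U : Subset m) → Nonempty U →
         ∃[ x ] x ∈ U × (∀ {y} → y ∈ U → f y ≤ f x)
argmax f (outside ∷ U) (suc x , there x∈U) with argmax (f ∘ suc) U (x , x∈U)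
... | y , y∈U , max = suc y , there y∈U , λ { (there z∈U) → max z∈U }
argmax f (inside ∷ U) _ with nonempty? U
... | no empty = zero , here , λ { here → ≤-refl ; (there z∈U) → contradiction (_ , z∈U) empty }
... | yes nonempty with argmax (f ∘ suc) U nonempty
...   | y , y∈U , max with ≤-total (f zero) (f (suc y))
...     | inj₁ f0≤fy = suc y , there y∈U , λ { here → f0≤fy ; (there z∈U) → max z∈U }
...     | inj₂ fy≤f0 = zero , here , λ { here → ≤-refl ; (there z∈U) → ≤-trans (max z∈U) fy≤f0 }

x∈p─q⇒x∉q : ∀ {m} {x : Fin m} (p q : Subset m) → x ∈ p ─ q → x ∉ q
x∈p─q⇒x∉q (_ ∷ p) (outside ∷ q) here ()
x∈p─q⇒x∉q (_ ∷ p) (_ ∷ q) (there x∈p─q) (there x∈q) = x∈p─q⇒x∉q p q x∈p─q x∈q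

x∉p-x : ∀ {m} {x : Fin m} (p : Subset m) → x ∉ p - x
x∉p-x {x = x} p x∈ = x∈p─q⇒x∉q p ⁅ x ⁆ x∈ (x∈⁅x⁆ x)

x∈p-y⇒x≢y : ∀ {m} {x y : Fin m} (p : Subset m) → x ∈ p - y → x ≢ y
x∈p-y⇒x≢y p x∈ refl = x∉p-x p x∈

∑ˢ : ∀ {n} → (Subset n → ℕ) → ℕ
∑ˢ {zero}  f = f []
∑ˢ {suc n} f = ∑ˢ (f ∘ (inside ∷_)) + ∑ˢ (f ∘ (outside ∷_))

term≤∑ˢ : ∀ {n} (f : Subset n → ℕ) A → f A ≤ ∑ˢ f
term≤∑ˢ f []            = ≤-refl
term≤∑ˢ f (inside ∷ A)  = ≤-trans (term≤∑ˢ (f ∘ (inside ∷_)) A) (m≤m+n _ _)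
term≤∑ˢ f (outside ∷ A) = ≤-trans (term≤∑ˢ (f ∘ (outside ∷_)) A) (m≤n+m _ _)

∑ˢ-mono-≤ : ∀ {n} {f g : Subset n → ℕ} → (∀ A → f A ≤ g A) → ∑ˢ f ≤ ∑ˢ g
∑ˢ-mono-≤ {zero}  f≤g = f≤g []
∑ˢ-mono-≤ {suc n} f≤g = +-mono-≤ (∑ˢ-mono-≤ (f≤g ∘ (inside ∷_))) (∑ˢ-mono-≤ (f≤g ∘ (outside ∷_)))

∑ˢ-cong : ∀ {n} {f g : Subset n → ℕ} → (∀ A → f A ≡ g A) → ∑ˢ f ≡ ∑ˢ g
∑ˢ-cong {zero}  f≡g = f≡g []
∑ˢ-cong {suc n} f≡g = cong₂ _+_ (∑ˢ-cong (f≡g ∘ (inside ∷_))) (∑ˢ-cong (f≡g ∘ (outside ∷_)))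

∑ˢ-+ : ∀ {n} (f g : Subset n → ℕ) → ∑ˢ (λ A → f A + g A) ≡ ∑ˢ f + ∑ˢ g
∑ˢ-+ {zero}  f g = refl
∑ˢ-+ {suc n} f g
  rewrite ∑ˢ-+ (f ∘ (inside ∷_)) (g ∘ (inside ∷_)) | ∑ˢ-+ (f ∘ (outside ∷_)) (g ∘ (outside ∷_)) =
  interchange (∑ˢ (f ∘ (inside ∷_))) _ _ _
  where
  interchange : ∀ a b c d → (a + b) + (c + d) ≡ (a + c) + (b + d)
  interchange = solve-∀

∑ˢ-* : ∀ {n} k (f : Subset n → ℕ) → ∑ˢ (λ A → k * f A) ≡ k * ∑ˢ f
∑ˢ-* {zero}  k f = refl
∑ˢ-* {suc n} k f =
  trans (cong₂ _+_ (∑ˢ-* {n} k _) (∑ˢ-* {n} k _)) (sym (*-distribˡ-+ k _ _))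

mark : ∀ {m} → ℕ → Subset m → Vec ℕ m → Vec ℕ m
mark β []            []      = []
mark β (inside ∷ B)  (a ∷ g) = β ∷ mark β B g
mark β (outside ∷ B) (a ∷ g) = a ∷ mark β B g

mark-⊥ : ∀ {m} β (g : Vec ℕ m) → mark β ⊥ g ≡ g
mark-⊥ β []      = refl
mark-⊥ β (a ∷ g) = cong (a ∷_) (mark-⊥ β g)

lookup-mark-∈ : ∀ {m} β {B : Subset m} g {e} → e ∈ B → lookup (mark β B g) e ≡ β
lookup-mark-∈ β {inside ∷ B}  (a ∷ g) here        = refl
lookup-mark-∈ β {inside ∷ B}  (a ∷ g) (there e∈B) = lookup-mark-∈ β g e∈B
lookup-mark-∈ β {outside ∷ B} (a ∷ g) (there e∈B) = lookup-mark-∈ β g e∈B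

lookup-mark-∉ : ∀ {m} β {B : Subset m} g e → e ∉ B → lookup (mark β B g) e ≡ lookup g e
lookup-mark-∉ β {inside ∷ B}  (a ∷ g) zero    e∉B = contradiction here e∉B
lookup-mark-∉ β {outside ∷ B} (a ∷ g) zero    e∉B = refl
lookup-mark-∉ β {inside ∷ B}  (a ∷ g) (suc e) e∉B = lookup-mark-∉ β g e (e∉B ∘ there)
lookup-mark-∉ β {outside ∷ B} (a ∷ g) (suc e) e∉B = lookup-mark-∉ β g e (e∉B ∘ there)

-- Splits Breaker's simultaneous answer into single claims, one for each induction step of
-- `Φ-breaker`.
mark-remove : ∀ {m} β {B : Subset m} g {y} → y ∈ B → mark β (B - y) (g [ y ]≔ β) ≡ mark β B g
mark-remove β {inside ∷ B}  (a ∷ g) here = cong (β ∷_) (cong (λ C → mark β C g) (p─⊥≡p B))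
mark-remove β {inside ∷ B}  (a ∷ g) (there y∈B) = cong (β ∷_) (mark-remove β g y∈B)
mark-remove β {outside ∷ B} (a ∷ g) (there y∈B) = cong (a ∷_) (mark-remove β g y∈B)

*-distrib-slope : ∀ c w h s → c * (w + h * s) ≡ c * w + h * (c * s)
*-distrib-slope = solve-∀

module Weight (γ : ℕ) where

  -- Elements outside `S` contribute γ, the colour of an unclaimed element. Every weight is thus a
  -- product of m factors, and the untouched board weighs γ^m whatever `S` is.
  weight : ∀ {m} → Subset m → Vec ℕ m → ℕ
  weight []            []      = 1
  weight (inside ∷ S)  (a ∷ g) = a * weight S g
  weight (outside ∷ S) (a ∷ g) = γ * weight S g

  -- The derivative of the weight of S with respect to the colour of the element.
  slope : ∀ {m} → Fin m → Subset m → Vec ℕ m → ℕ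
  slope zero    (inside ∷ S)  (a ∷ g) = weight S g
  slope zero    (outside ∷ S) (a ∷ g) = 0
  slope (suc x) (inside ∷ S)  (a ∷ g) = a * slope x S g
  slope (suc x) (outside ∷ S) (a ∷ g) = γ * slope x S g

  weight-linear : ∀ {m} x (S : Subset m) g a h →
    weight S (g [ x ]≔ (a + h)) ≡ weight S (g [ x ]≔ a) + h * slope x S g
  weight-linear zero (inside ∷ S) (c ∷ g) a h = *-distribʳ-+ (weight S g) a h
  weight-linear zero (outside ∷ S) (c ∷ g) a h =
    trans (sym (+-identityʳ _)) (cong (γ * weight S g +_) (sym (*-zeroʳ h)))
  weight-linear (suc x) (inside ∷ S) (c ∷ g) a h
    rewrite weight-linear x S g a h = *-distrib-slope c (weight S (g [ x ]≔ a)) h (slope x S g)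
  weight-linear (suc x) (outside ∷ S) (c ∷ g) a h
    rewrite weight-linear x S g a h = *-distrib-slope γ (weight S (g [ x ]≔ a)) h (slope x S g)

  *-mono-exchange : ∀ k k′ c c′ w → k * c ≤ k′ * c′ → k * (c * w) ≤ k′ * (c′ * w)
  *-mono-exchange k k′ c c′ w kc≤k′c′ = begin
    k * (c * w)   ≡⟨ *-assoc k c w ⟨
    k * c * w     ≤⟨ *-monoˡ-≤ w kc≤k′c′ ⟩
    k′ * c′ * w   ≡⟨ *-assoc k′ c′ w ⟩
    k′ * (c′ * w) ∎
    where open ≤-Reasoning

  private
    scale : ∀ k k′ c w w′ → k * w ≤ k′ * w′ → k * (c * w) ≤ k′ * (c * w′)
    scale k k′ c w w′ kw≤k′w′ = begin
      k * (c * w)   ≡⟨ x∙yz≈y∙xz k c w ⟩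
      c * (k * w)   ≤⟨ *-monoʳ-≤ c kw≤k′w′ ⟩
      c * (k′ * w′) ≡⟨ x∙yz≈y∙xz c k′ w′ ⟩
      k′ * (c * w′) ∎
      where
      open ≤-Reasoning

  -- The fraction k′ / k bounds the effect of one recolouring: if x lies in `S`, one factor changes
  -- and the first inequality applies; otherwise the weight stays the same and k ≤ k′ suffices.
  weight-update-≤ : ∀ {m} k k′ a (S : Subset m) g x → k * a ≤ k′ * lookup g x → k ≤ k′ →
    k * weight S (g [ x ]≔ a) ≤ k′ * weight S g
  weight-update-≤ k k′ a (inside ∷ S) (c ∷ g) zero ka≤k′c k≤k′ = *-mono-exchange k k′ a c _ ka≤k′c
  weight-update-≤ k k′ a (outside ∷ S) (c ∷ g) zero ka≤k′c k≤k′ = *-monoˡ-≤ _ k≤k′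
  weight-update-≤ k k′ a (inside ∷ S) (c ∷ g) (suc x) ka≤k′c k≤k′ =
    scale k k′ c _ _ (weight-update-≤ k k′ a S g x ka≤k′c k≤k′)
  weight-update-≤ k k′ a (outside ∷ S) (c ∷ g) (suc x) ka≤k′c k≤k′ =
    scale k k′ γ _ _ (weight-update-≤ k k′ a S g x ka≤k′c k≤k′)

  slope-update-≤ : ∀ {m} k k′ a y (S : Subset m) g x → k * a ≤ k′ * lookup g x → k ≤ k′ →
    k * slope y S (g [ x ]≔ a) ≤ k′ * slope y S g
  slope-update-≤ k k′ a zero (inside ∷ S) (c ∷ g) zero _ k≤k′ = *-monoˡ-≤ _ k≤k′
  slope-update-≤ k k′ a zero (inside ∷ S) (c ∷ g) (suc x) ka≤ k≤k′ = weight-update-≤ k k′ a S g x ka≤ k≤k′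
  slope-update-≤ k k′ a zero (outside ∷ S) (c ∷ g) zero _ k≤k′ = *-monoˡ-≤ 0 k≤k′
  slope-update-≤ k k′ a zero (outside ∷ S) (c ∷ g) (suc x) _ k≤k′ = *-monoˡ-≤ 0 k≤k′
  slope-update-≤ k k′ a (suc y) (inside ∷ S) (c ∷ g) zero ka≤k′c _ = *-mono-exchange k k′ a c _ ka≤k′c
  slope-update-≤ k k′ a (suc y) (outside ∷ S) (c ∷ g) zero _ k≤k′ = *-monoˡ-≤ _ k≤k′
  slope-update-≤ k k′ a (suc y) (inside ∷ S) (c ∷ g) (suc x) ka≤ k≤k′ =
    scale k k′ c _ _ (slope-update-≤ k k′ a y S g x ka≤ k≤k′)
  slope-update-≤ k k′ a (suc y) (outside ∷ S) (c ∷ g) (suc x) ka≤ k≤k′ =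
    scale k k′ γ _ _ (slope-update-≤ k k′ a y S g x ka≤ k≤k′)

  weight-replicate : ∀ {m} (S : Subset m) → weight S (replicate m γ) ≡ γ ^ m
  weight-replicate []            = refl
  weight-replicate (inside ∷ S)  = cong (γ *_) (weight-replicate S)
  weight-replicate (outside ∷ S) = cong (γ *_) (weight-replicate S)

-- A colour records who owns an element: α Maker, β Breaker, γ nobody.
module Stage {m n : ℕ} (b : ℕ) (init : Subset n → ℕ) (S : Subset n → Subset m)
             (α μ η : ℕ) .{{_ : NonZero (α + μ)}}
             (fair : (α + μ) * ((α + μ) + η) ^ b ≤ (α + μ) ^ suc b + (α + μ) ^ b * μ) where

  γ = α + μ
  β = γ + η

  open Weight γ

  Φ : Vec ℕ m → ℕ
  Φ g = ∑ˢ λ A → init A * weight (S A) g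

  Δ : Fin m → Vec ℕ m → ℕ
  Δ x g = ∑ˢ λ A → init A * slope x (S A) g

  Φ-linear : ∀ x g a h → Φ (g [ x ]≔ (a + h)) ≡ Φ (g [ x ]≔ a) + h * Δ x g
  Φ-linear x g a h = begin
    Φ (g [ x ]≔ (a + h))
      ≡⟨ ∑ˢ-cong (λ A → trans (cong (init A *_) (weight-linear x (S A) g a h))
                               (*-distrib-slope (init A) (weight (S A) (g [ x ]≔ a)) h (slope x (S A) g))) ⟩
    ∑ˢ (λ A → init A * weight (S A) (g [ x ]≔ a) + h * (init A * slope x (S A) g))
      ≡⟨ ∑ˢ-+ {n} _ _ ⟩
    Φ (g [ x ]≔ a) + ∑ˢ (λ A → h * (init A * slope x (S A) g))
      ≡⟨ cong (Φ (g [ x ]≔ a) +_) (∑ˢ-* {n} h _) ⟩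
    Φ (g [ x ]≔ a) + h * Δ x g ∎
    where
    open ≡-Reasoning

  Δ-update-≤ : ∀ k k′ a y g x → k * a ≤ k′ * lookup g x → k ≤ k′ →
    k * Δ y (g [ x ]≔ a) ≤ k′ * Δ y g
  Δ-update-≤ k k′ a y g x ka≤ k≤k′ = begin
    k * Δ y (g [ x ]≔ a)                                   ≡⟨ ∑ˢ-* {n} k _ ⟨
    ∑ˢ (λ A → k * (init A * slope y (S A) (g [ x ]≔ a)))
      ≤⟨ ∑ˢ-mono-≤ (λ A → subst₂ _≤_ (x∙yz≈y∙xz (init A) k _) (x∙yz≈y∙xz (init A) k′ _)
           (*-monoʳ-≤ (init A) (slope-update-≤ k k′ a y (S A) g x ka≤ k≤k′))) ⟩
    ∑ˢ (λ A → k′ * (init A * slope y (S A) g))             ≡⟨ ∑ˢ-* {n} k′ _ ⟩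
    k′ * Δ y g                                             ∎
    where
    open ≤-Reasoning

  update-self : ∀ (g : Vec ℕ m) x → lookup g x ≡ γ → g [ x ]≔ γ ≡ g
  update-self g x gx≡γ = subst (λ c → g [ x ]≔ c ≡ g) gx≡γ ([]≔-lookup g x)

  -- Each single claim of Breaker multiplies all slopes by at most β / γ.
  Φ-breaker : ∀ t B g c D → (∀ {y} → y ∈ B → lookup g y ≡ γ) → ∣ B ∣ ≤ t →
    (∀ {y} → y ∈ B → c * Δ y g ≤ D) →
    c * γ ^ t * Φ (mark β B g) + γ ^ suc t * D ≤ c * γ ^ t * Φ g + γ * β ^ t * D
  Φ-breaker t B g c D free ∣B∣≤t steep with nonempty? B
  ... | no empty rewrite Empty-unique empty | mark-⊥ β g =
    +-monoʳ-≤ (c * γ ^ t * Φ g) (*-monoˡ-≤ D (*-monoʳ-≤ γ (^-monoˡ-≤ t (m≤m+n γ η))))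
  Φ-breaker zero B g c D free ∣B∣≤t steep | yes (y , y∈B) =
    contradiction ∣B∣≤t (<⇒≱ (≤-<-trans z≤n (x∈p⇒∣p-x∣<∣p∣ y∈B)))
  Φ-breaker (suc t) B g c D free ∣B∣≤t steep | yes (y , y∈B) = begin
    c * (γ * γ ^ t) * Φ (mark β B g) + γ * (γ * γ ^ t) * D
      ≡⟨ cong (λ h → c * (γ * γ ^ t) * Φ h + γ * (γ * γ ^ t) * D) (mark-remove β g y∈B) ⟨
    c * (γ * γ ^ t) * Φ (mark β (B - y) g′) + γ * (γ * γ ^ t) * D
      ≤⟨ +-cancelʳ-≤ (γ * γ ^ t * (β * D)) _ _ combine ⟩
    c * (γ * γ ^ t) * Φ g + γ * (β * β ^ t) * D ∎
    where
    open ≤-Reasoning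
    g′ = g [ y ]≔ β
    -- Slopes are bounded by the fraction D / c, which one claim of Breaker raises to β D / (γ c).
    -- The increments η D / c, η β D / (γ c), ... form a geometric series with sum γ ((β / γ)^t - 1)
    -- D / c.
    IH : c * γ * γ ^ t * Φ (mark β (B - y) g′) + γ ^ suc t * (β * D)
         ≤ c * γ * γ ^ t * Φ g′ + γ * β ^ t * (β * D)
    IH = Φ-breaker t (B - y) g′ (c * γ) (β * D)
      (λ z∈ → trans (lookup∘update′ (x∈p-y⇒x≢y B z∈) g β) (free (p─q⊆p B ⁅ y ⁆ z∈)))
      (≤-pred (≤-trans (x∈p⇒∣p-x∣<∣p∣ y∈B) ∣B∣≤t))
      (λ {z} z∈ → begin
        c * γ * Δ z g′     ≡⟨ *-assoc c γ _ ⟩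
        c * (γ * Δ z g′)   ≤⟨ *-monoʳ-≤ c (Δ-update-≤ γ β β z g y
                                (≤-reflexive (trans (*-comm γ β) (cong (β *_) (sym (free y∈B))))) (m≤m+n γ η)) ⟩
        c * (β * Δ z g)    ≡⟨ x∙yz≈y∙xz c β (Δ z g) ⟩
        β * (c * Δ z g)    ≤⟨ *-monoʳ-≤ β (steep (p─q⊆p B ⁅ y ⁆ z∈)) ⟩
        β * D              ∎)
    step : Φ g′ ≡ Φ g + η * Δ y g
    step = trans (Φ-linear y g γ η) (cong (λ h → Φ h + η * Δ y g) (update-self g y (free y∈B)))
    combine : (c * (γ * γ ^ t) * Φ (mark β (B - y) g′) + γ * (γ * γ ^ t) * D) + γ * γ ^ t * (β * D)
              ≤ (c * (γ * γ ^ t) * Φ g + γ * (β * β ^ t) * D) + γ * γ ^ t * (β * D)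
    combine = begin
      (c * (γ * γ ^ t) * Φ (mark β (B - y) g′) + γ * (γ * γ ^ t) * D) + γ * γ ^ t * (β * D)
        ≡⟨ e₁ c γ (γ ^ t) (Φ (mark β (B - y) g′)) D (β * D) ⟩
      (c * γ * γ ^ t * Φ (mark β (B - y) g′) + γ ^ suc t * (β * D)) + γ * γ ^ t * (γ * D)
        ≤⟨ +-monoˡ-≤ _ IH ⟩
      c * γ * γ ^ t * Φ g′ + γ * β ^ t * (β * D) + γ * γ ^ t * (γ * D)
        ≡⟨ cong (λ φ → c * γ * γ ^ t * φ + γ * β ^ t * (β * D) + γ * γ ^ t * (γ * D)) step ⟩
      c * γ * γ ^ t * (Φ g + η * Δ y g) + γ * β ^ t * (β * D) + γ * γ ^ t * (γ * D)
        ≡⟨ e₂ c γ (γ ^ t) (Φ g) η (Δ y g) (β ^ t) β D ⟩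
      c * (γ * γ ^ t) * Φ g + γ * (β * β ^ t) * D + γ * γ ^ t * (η * (c * Δ y g) + γ * D)
        ≤⟨ +-monoʳ-≤ (c * (γ * γ ^ t) * Φ g + γ * (β * β ^ t) * D)
             (*-monoʳ-≤ (γ * γ ^ t) (+-monoˡ-≤ (γ * D) (*-monoʳ-≤ η (steep y∈B)))) ⟩
      c * (γ * γ ^ t) * Φ g + γ * (β * β ^ t) * D + γ * γ ^ t * (η * D + γ * D)
        ≡⟨ cong (λ d → c * (γ * γ ^ t) * Φ g + γ * (β * β ^ t) * D + γ * γ ^ t * d)
             (trans (+-comm (η * D) (γ * D)) (sym (*-distribʳ-+ D γ η))) ⟩
      c * (γ * γ ^ t) * Φ g + γ * (β * β ^ t) * D + γ * γ ^ t * (β * D) ∎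
      where
      e₁ : ∀ c g gt f d bd → (c * (g * gt) * f + g * (g * gt) * d) + g * gt * bd
                             ≡ (c * g * gt * f + g * gt * bd) + g * gt * (g * d)
      e₁ = solve-∀
      e₂ : ∀ c g gt f h y bt β d → c * g * gt * (f + h * y) + g * bt * (β * d) + g * gt * (g * d)
                             ≡ c * (g * gt) * f + g * (β * bt) * d + g * gt * (h * (c * y) + g * d)
      e₂ = solve-∀

  -- Maker's claim lowers Φ by exactly `μ * D` and raises no slope, since α ≤ γ, so every slope open
  -- to Breaker is still at most `D`. His b claims then add at most γ ((β / γ)^b - 1) D, which
  -- `fair` bounds by `μ * D`.
  Φ-turn : ∀ g x B → lookup g x ≡ γ → (∀ {y} → y ∈ B → y ≢ x × lookup g y ≡ γ) → ∣ B ∣ ≤ b →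
    (∀ {y} → y ∈ B → Δ y g ≤ Δ x g) → Φ (mark β B (g [ x ]≔ α)) ≤ Φ g
  Φ-turn g x B gx≡γ free ∣B∣≤b steepest =
    *-cancelˡ-≤ (γ ^ b) {{m^n≢0 γ b}} (+-cancelʳ-≤ (γ ^ suc b * D) _ _ (begin
      γ ^ b * Φ (mark β B g′) + γ ^ suc b * D
        ≡⟨ cong (λ k → k * Φ (mark β B g′) + γ ^ suc b * D) (*-identityˡ (γ ^ b)) ⟨
      1 * γ ^ b * Φ (mark β B g′) + γ ^ suc b * D
        ≤⟨ Φ-breaker b B g′ 1 D
             (λ y∈B → trans (lookup∘update′ (proj₁ (free y∈B)) g α) (proj₂ (free y∈B))) ∣B∣≤b
             (λ {y} y∈B → ≤-trans (Δ-update-≤ 1 1 α y g x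
                (*-monoʳ-≤ 1 (≤-trans (m≤m+n α μ) (≤-reflexive (sym gx≡γ)))) ≤-refl)
                (≤-trans (≤-reflexive (*-identityˡ _)) (steepest y∈B))) ⟩
      1 * γ ^ b * Φ g′ + γ * β ^ b * D
        ≤⟨ +-monoʳ-≤ (1 * γ ^ b * Φ g′) (*-monoˡ-≤ D fair) ⟩
      1 * γ ^ b * Φ g′ + (γ ^ suc b + γ ^ b * μ) * D
        ≡⟨ e (γ ^ b) (Φ g′) (γ ^ suc b) μ D ⟩
      γ ^ b * (Φ g′ + μ * D) + γ ^ suc b * D
        ≡⟨ cong (λ φ → γ ^ b * φ + γ ^ suc b * D)
             (trans (sym (Φ-linear x g α μ)) (cong Φ (update-self g x gx≡γ))) ⟩
      γ ^ b * Φ g + γ ^ suc b * D ∎))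
    where
    open ≤-Reasoning
    D = Δ x g
    g′ = g [ x ]≔ α
    e : ∀ p f q μ d → 1 * p * f + (q + p * μ) * d ≡ p * (f + μ * d) + q * d
    e = solve-∀

  module _ (X : Subset m) where

    -- Maker's elements enter only through the lower bound `α≤`, because at the end of a stage a
    -- lower bound on each weight is what gets compared with Φ.
    record Colouring (U M : Subset m) (g : Vec ℕ m) : Set where
      field
        free    : ∀ {e} → e ∈ U → lookup g e ≡ γ
        breaker : ∀ {e} → e ∈ X → e ∉ U → e ∉ M → lookup g e ≡ β
        α≤      : ∀ e → α ≤ lookup g e
    open Colouring

    initial : Colouring X ⊥ (replicate m γ)
    initial = record
      { free    = λ {e} _ → lookup-replicate e γ
      ; breaker = λ e∈X e∉X → contradiction e∈X e∉X
      ; α≤      = λ e → subst (α ≤_) (sym (lookup-replicate e γ)) (m≤m+n α μ)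
      }

    turn : ∀ {U M g x B} → Colouring U M g → x ∈ U → B ⊆ U - x →
           Colouring ((U - x) ─ B) (M ∪ ⁅ x ⁆) (mark β B (g [ x ]≔ α))
    turn {U} {M} {g} {x} {B} col x∈U B⊆U-x = record
      { free    = λ {e} e∈ → let e∈U-x = p─q⊆p (U - x) B e∈ in begin
          lookup (mark β B g′) e ≡⟨ lookup-mark-∉ β g′ e (x∈p─q⇒x∉q (U - x) B e∈) ⟩
          lookup g′ e            ≡⟨ lookup∘update′ (x∈p-y⇒x≢y U e∈U-x) g α ⟩
          lookup g e             ≡⟨ free col (p─q⊆p U ⁅ x ⁆ e∈U-x) ⟩
          γ                      ∎
      ; breaker = breaker′
      ; α≤      = α≤′
      }
      where
      open ≡-Reasoning
      g′ = g [ x ]≔ α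
      breaker′ : ∀ {e} → e ∈ X → e ∉ (U - x) ─ B → e ∉ M ∪ ⁅ x ⁆ → lookup (mark β B g′) e ≡ β
      breaker′ {e} e∈X e∉U e∉M with e ∈? B
      ... | yes e∈B = lookup-mark-∈ β g′ e∈B
      ... | no  e∉B = begin
        lookup (mark β B g′) e ≡⟨ lookup-mark-∉ β g′ e e∉B ⟩
        lookup g′ e            ≡⟨ lookup∘update′ e≢x g α ⟩
        lookup g e             ≡⟨ breaker col e∈X
          (λ e∈U → e∉U (x∈p∧x∉q⇒x∈p─q (x∈p∧x≢y⇒x∈p-y e∈U e≢x) e∉B))
          (λ e∈M → e∉M (p⊆p∪q ⁅ x ⁆ e∈M)) ⟩
        β                      ∎
        where
        e≢x : e ≢ x
        e≢x refl = e∉M (q⊆p∪q M ⁅ x ⁆ (x∈⁅x⁆ x))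
      α≤′ : ∀ e → α ≤ lookup (mark β B g′) e
      α≤′ e with e ∈? B
      ... | yes e∈B = subst (α ≤_) (sym (lookup-mark-∈ β g′ e∈B)) (≤-trans (m≤m+n α μ) (m≤m+n γ η))
      ... | no  e∉B with e Fin.≟ x
      ...   | yes refl = ≤-reflexive (sym (trans (lookup-mark-∉ β g′ e e∉B) (lookup∘update e g α)))
      ...   | no  e≢x  = subst (α ≤_)
        (sym (trans (lookup-mark-∉ β g′ e e∉B) (lookup∘update′ e≢x g α))) (α≤ col e)

    steepestClaim : ∀ {Goal} φ fuel U M g → ∣ U ∣ ≤ fuel → Colouring U M g → Φ g ≤ φ →
      (∀ {U M g} → Empty U → Colouring U M g → Φ g ≤ φ → Goal M) → StageStrategy b Goal U M
    steepestClaim φ fuel U M g ∣U∣≤ col Φ≤φ goal with nonempty? U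
    ... | no empty = end empty (goal empty col Φ≤φ)
    steepestClaim φ zero U M g ∣U∣≤ col Φ≤φ goal | yes (y , y∈U) =
      contradiction ∣U∣≤ (<⇒≱ (≤-<-trans z≤n (x∈p⇒∣p-x∣<∣p∣ y∈U)))
    steepestClaim φ (suc fuel) U M g ∣U∣≤ col Φ≤φ goal | yes nonempty
      with argmax (λ x → Δ x g) U nonempty
    ... | x , x∈U , steepest = claim x x∈U λ B B⊆U-x ∣B∣≤b →
      steepestClaim φ fuel _ _ (mark β B (g [ x ]≔ α))
        (≤-trans (∣p─q∣≤∣p∣ (U - x) B) (≤-pred (≤-trans (x∈p⇒∣p-x∣<∣p∣ x∈U) ∣U∣≤)))
        (turn col x∈U B⊆U-x)
        (≤-trans (Φ-turn g x B (free col x∈U)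
          (λ y∈B → x∈p-y⇒x≢y U (B⊆U-x y∈B) , free col (p─q⊆p U ⁅ x ⁆ (B⊆U-x y∈B))) ∣B∣≤b
          (λ y∈B → steepest (p─q⊆p U ⁅ x ⁆ (B⊆U-x y∈B)))) Φ≤φ)
        goal

-- Multistage games on subsets

∣p∪q∣≤∣p∣+∣q∣ : ∀ {m} (p q : Subset m) → ∣ p ∪ q ∣ ≤ ∣ p ∣ + ∣ q ∣
∣p∪q∣≤∣p∣+∣q∣ [] [] = z≤n
∣p∪q∣≤∣p∣+∣q∣ (outside ∷ p) (outside ∷ q) = ∣p∪q∣≤∣p∣+∣q∣ p q
∣p∪q∣≤∣p∣+∣q∣ (outside ∷ p) (inside ∷ q) =
  ≤-trans (s≤s (∣p∪q∣≤∣p∣+∣q∣ p q)) (≤-reflexive (sym (+-suc ∣ p ∣ ∣ q ∣)))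
∣p∪q∣≤∣p∣+∣q∣ (inside ∷ p) (outside ∷ q) = s≤s (∣p∪q∣≤∣p∣+∣q∣ p q)
∣p∪q∣≤∣p∣+∣q∣ (inside ∷ p) (inside ∷ q) =
  s≤s (≤-trans (∣p∪q∣≤∣p∣+∣q∣ p q) (+-monoʳ-≤ ∣ p ∣ (n≤1+n ∣ q ∣)))

q⊆p⇒∣p─q∣+∣q∣≡∣p∣ : ∀ {m} (p q : Subset m) → q ⊆ p → ∣ p ─ q ∣ + ∣ q ∣ ≡ ∣ p ∣
q⊆p⇒∣p─q∣+∣q∣≡∣p∣ [] [] q⊆p = refl
q⊆p⇒∣p─q∣+∣q∣≡∣p∣ (outside ∷ p) (outside ∷ q) q⊆p = q⊆p⇒∣p─q∣+∣q∣≡∣p∣ p q (drop-∷-⊆ q⊆p)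
q⊆p⇒∣p─q∣+∣q∣≡∣p∣ (outside ∷ p) (inside ∷ q) q⊆p with q⊆p here
... | ()
q⊆p⇒∣p─q∣+∣q∣≡∣p∣ (inside ∷ p) (outside ∷ q) q⊆p = cong suc (q⊆p⇒∣p─q∣+∣q∣≡∣p∣ p q (drop-there ∘ q⊆p ∘ there))
q⊆p⇒∣p─q∣+∣q∣≡∣p∣ (inside ∷ p) (inside ∷ q) q⊆p =
  trans (+-suc ∣ p ─ q ∣ ∣ q ∣) (cong suc (q⊆p⇒∣p─q∣+∣q∣≡∣p∣ p q (drop-∷-⊆ q⊆p)))

subsetOfSize : ∀ {m} k (p : Subset m) → k ≤ ∣ p ∣ → ∃[ q ] q ⊆ p × ∣ q ∣ ≡ k
subsetOfSize {m} zero p k≤ = ⊥ , (λ x∈⊥ → contradiction x∈⊥ ∉⊥) , ∣⊥∣≡0 m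
subsetOfSize (suc k) (inside ∷ p) (s≤s k≤) with subsetOfSize k p k≤
... | q , q⊆p , ∣q∣≡k = inside ∷ q , in⊆in q⊆p , cong suc ∣q∣≡k
subsetOfSize (suc k) (outside ∷ p) k≤ with subsetOfSize (suc k) p k≤
... | q , q⊆p , ∣q∣≡k = outside ∷ q , out⊆ q⊆p , ∣q∣≡k

-- Supplies τ. Constructively, a bounded property has a largest witness only if it can be searched,
-- which is why the game is decided below.
maximum : ∀ (Q : ℕ → Set) → Decidable Q → Q 0 → ∀ bound → (∀ s → Q s → s ≤ bound) →
          ∃[ t ] Q t × (∀ s → Q s → s ≤ t)
maximum Q Q? Q0 zero      below = 0 , Q0 , below
maximum Q Q? Q0 (suc bound) below with Q? (suc bound)
... | yes Qt = suc bound , Qt , below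
... | no ¬Qt = maximum Q Q? Q0 bound λ s Qs →
  ≤-pred (≤∧≢⇒< (below s Qs) λ s≡ → ¬Qt (subst Q s≡ Qs))

module _ {m : ℕ} {b : ℕ} where

  -- The new goal may use that Maker's final set lies inside `U ∪ M`. This shows, stage after stage,
  -- that a winning set inside the new board also fits into the old one.
  mapGoal : ∀ {G G′ : Subset m → Set} {U M} → (∀ {X} → X ⊆ U ∪ M → G X → G′ X) →
            StageStrategy b G U M → StageStrategy b G′ U M
  mapGoal {U = U} {M} f (end empty goal) = end empty (f (q⊆p∪q U M) goal)
  mapGoal {U = U} {M} f (claim x x∈U next) = claim x x∈U λ B B⊆ ∣B∣≤b →
    mapGoal (λ X⊆ → f (λ e∈X → owned B (X⊆ e∈X))) (next B B⊆ ∣B∣≤b)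
    where
    owned : ∀ B {e} → e ∈ ((U - x) ─ B) ∪ (M ∪ ⁅ x ⁆) → e ∈ U ∪ M
    owned B e∈ with x∈p∪q⁻ ((U - x) ─ B) (M ∪ ⁅ x ⁆) e∈
    ... | inj₁ e∈U = p⊆p∪q M (p─q⊆p U ⁅ x ⁆ (p─q⊆p (U - x) B e∈U))
    ... | inj₂ e∈M∪x with x∈p∪q⁻ M ⁅ x ⁆ e∈M∪x
    ...   | inj₁ e∈M = q⊆p∪q U M e∈M
    ...   | inj₂ e∈x with x∈⁅y⁆⇒x≡y x e∈x
    ...     | refl = p⊆p∪q M x∈U

  stageStrategy? : ∀ {G : Subset m → Set} → Decidable G → ∀ fuel U M → ∣ U ∣ ≤ fuel →
                   Dec (StageStrategy b G U M)
  stageStrategy? G? fuel U M ∣U∣≤ with nonempty? U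
  ... | no empty = map′ (end empty) (λ { (end _ goal) → goal
                                       ; (claim x x∈U _) → contradiction (x , x∈U) empty }) (G? M)
  stageStrategy? G? zero U M ∣U∣≤ | yes (x , x∈U) =
    contradiction ∣U∣≤ (<⇒≱ (≤-<-trans z≤n (x∈p⇒∣p-x∣<∣p∣ x∈U)))
  stageStrategy? {G} G? (suc fuel) U M ∣U∣≤ | yes nonempty =
    map′ (λ (x , x∈U , next) → claim x x∈U next)
         (λ { (end empty _) → contradiction nonempty empty
            ; (claim x x∈U next) → x , x∈U , next })
         (Fin.any? claim?)
    where
    Next : Fin m → Subset m → Set
    Next x B = B ⊆ U - x → ∣ B ∣ ≤ b → StageStrategy b G ((U - x) ─ B) (M ∪ ⁅ x ⁆)
    claim? : ∀ x → Dec (∃[ x∈U ] (∀ B → Next x B))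
    claim? x with x ∈? U
    ... | no x∉U = no λ (x∈U , _) → x∉U x∈U
    ... | yes x∈U with anySubset? (¬? ∘ next?)
      where
      next? : ∀ B → Dec (Next x B)
      next? B = B ⊆? (U - x) →-dec (∣ B ∣ ≤? b →-dec stageStrategy? G? fuel ((U - x) ─ B) (M ∪ ⁅ x ⁆)
        (≤-trans (∣p─q∣≤∣p∣ (U - x) B) (≤-pred (≤-trans (x∈p⇒∣p-x∣<∣p∣ x∈U) ∣U∣≤))))
    ...   | yes (B , ¬next) = no λ (_ , next) → ¬next (next B)
    -- The search yields only that no answer `B` refutes the claim of `x`; decidability of the rest
    -- of the stage turns this double negation into strategies.
    ...   | no ¬∃ = yes (x∈U , λ B B⊆ ∣B∣≤b → decidable-stable
              (stageStrategy? G? fuel _ _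
                (≤-trans (∣p─q∣≤∣p∣ (U - x) B) (≤-pred (≤-trans (x∈p⇒∣p-x∣<∣p∣ x∈U) ∣U∣≤))))
              (λ ¬s → ¬∃ (B , λ next → ¬s (next B⊆ ∣B∣≤b))))

  -- Breaker takes exactly b elements while b are left, so each element of Maker uses up b + 1. The
  -- summand b rounds up for an incomplete last round.
  greedyBreaker : ∀ {G : Subset m → Set} {U M} → StageStrategy b G U M →
    ∃[ X ] G X × suc b * ∣ X ∣ ≤ suc b * ∣ M ∣ + (∣ U ∣ + b)
  greedyBreaker {M = M} (end empty goal) = M , goal , m≤m+n _ _
  greedyBreaker {U = U} {M} (claim x x∈U next) = respond (≤-total b ∣ U - x ∣)
    where
    open ≤-Reasoning
    ∣U∣ : suc ∣ U - x ∣ ≡ ∣ U ∣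
    ∣U∣ = trans (trans (sym (+-comm ∣ U - x ∣ 1)) (cong (∣ U - x ∣ +_) (sym (∣⁅x⁆∣≡1 x))))
                (q⊆p⇒∣p─q∣+∣q∣≡∣p∣ U ⁅ x ⁆ (λ y∈ → subst (_∈ U) (sym (x∈⁅y⁆⇒x≡y x y∈)) x∈U))
    ∣M∪x∣ : ∣ M ∪ ⁅ x ⁆ ∣ ≤ ∣ M ∣ + 1
    ∣M∪x∣ = ≤-trans (∣p∪q∣≤∣p∣+∣q∣ M ⁅ x ⁆) (≤-reflexive (cong (∣ M ∣ +_) (∣⁅x⁆∣≡1 x)))
    respond : b ≤ ∣ U - x ∣ ⊎ ∣ U - x ∣ ≤ b →
              ∃[ X ] _ × suc b * ∣ X ∣ ≤ suc b * ∣ M ∣ + (∣ U ∣ + b)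
    respond (inj₁ b≤) with subsetOfSize b (U - x) b≤
    ... | B , B⊆ , ∣B∣≡b with greedyBreaker (next B B⊆ (≤-reflexive ∣B∣≡b))
    ...   | X , goal , ∣X∣≤ = X , goal , (begin
      suc b * ∣ X ∣                                        ≤⟨ ∣X∣≤ ⟩
      suc b * ∣ M ∪ ⁅ x ⁆ ∣ + (∣ (U - x) ─ B ∣ + b)        ≤⟨ +-monoˡ-≤ _ (*-monoʳ-≤ (suc b) ∣M∪x∣) ⟩
      suc b * (∣ M ∣ + 1) + (∣ (U - x) ─ B ∣ + b)          ≡⟨ cong (λ k → suc b * (∣ M ∣ + 1) + (∣ (U - x) ─ B ∣ + k)) ∣B∣≡b ⟨
      suc b * (∣ M ∣ + 1) + (∣ (U - x) ─ B ∣ + ∣ B ∣)      ≡⟨ cong (suc b * (∣ M ∣ + 1) +_) (q⊆p⇒∣p─q∣+∣q∣≡∣p∣ (U - x) B B⊆) ⟩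
      suc b * (∣ M ∣ + 1) + ∣ U - x ∣                      ≡⟨ e b ∣ M ∣ ∣ U - x ∣ ⟩
      suc b * ∣ M ∣ + (suc ∣ U - x ∣ + b)                  ≡⟨ cong (λ u → suc b * ∣ M ∣ + (u + b)) ∣U∣ ⟩
      suc b * ∣ M ∣ + (∣ U ∣ + b)                          ∎)
      where
      e : ∀ b M u → suc b * (M + 1) + u ≡ suc b * M + (suc u + b)
      e = solve-∀
    -- At most b elements remain and Breaker takes them all. The induction hypothesis adds its b
    -- once more, but this leaves `suc b * ∣ X ∣` strictly below `suc b * (∣ M ∣ + 2)`, and
    -- integrality gives |X| ≤ |M| + 1.
    respond (inj₂ ≤b) with greedyBreaker (next (U - x) (λ y∈ → y∈) ≤b)
    ... | X , goal , ∣X∣≤ = X , goal , (begin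
      suc b * ∣ X ∣                           ≤⟨ *-monoʳ-≤ (suc b) {y = ∣ M ∣ + 1} (≤-pred (*-cancelˡ-< (suc b) _ _ bound)) ⟩
      suc b * (∣ M ∣ + 1)                     ≡⟨ e₁ b ∣ M ∣ ⟩
      suc b * ∣ M ∣ + (1 + b)                 ≤⟨ +-monoʳ-≤ (suc b * ∣ M ∣) (+-monoˡ-≤ b (subst (1 ≤_) ∣U∣ (s≤s z≤n))) ⟩
      suc b * ∣ M ∣ + (∣ U ∣ + b)             ∎)
      where
      e₁ : ∀ b M → suc b * (M + 1) ≡ suc b * M + (1 + b)
      e₁ = solve-∀
      e₂ : ∀ b M → suc (suc b * (M + 1) + b) ≡ suc b * suc (M + 1)
      e₂ = solve-∀
      nothing-left : ∣ (U - x) ─ (U - x) ∣ ≡ 0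
      nothing-left = +-cancelʳ-≡ ∣ U - x ∣ _ _ (q⊆p⇒∣p─q∣+∣q∣≡∣p∣ (U - x) (U - x) (λ y∈ → y∈))
      bound : suc (suc b * ∣ X ∣) ≤ suc b * suc (∣ M ∣ + 1)
      bound = begin
        suc (suc b * ∣ X ∣)                                            ≤⟨ s≤s ∣X∣≤ ⟩
        suc (suc b * ∣ M ∪ ⁅ x ⁆ ∣ + (∣ (U - x) ─ (U - x) ∣ + b))      ≡⟨ cong (λ k → suc (suc b * ∣ M ∪ ⁅ x ⁆ ∣ + (k + b))) nothing-left ⟩
        suc (suc b * ∣ M ∪ ⁅ x ⁆ ∣ + b)                                ≤⟨ s≤s (+-monoˡ-≤ b (*-monoʳ-≤ (suc b) ∣M∪x∣)) ⟩
        suc (suc b * (∣ M ∣ + 1) + b)                                  ≡⟨ e₂ b ∣ M ∣ ⟩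
        suc b * suc (∣ M ∣ + 1)                                        ∎

module MonotoneGame {m : ℕ} (b : ℕ) (P : Subset m → Set) where

  -- The surviving family is determined by the board, being the original winning sets that fit into
  -- it. The family can therefore be dropped, and only the last board is tested.
  Wins : ℕ → Subset m → Set
  Wins zero    X = P X
  Wins (suc s) X = StageStrategy b (Wins s) X ⊥

  wins? : Decidable P → ∀ s → Decidable (Wins s)
  wins? P? zero    X = P? X
  wins? P? (suc s) X = stageStrategy? (wins? P? s) ∣ X ∣ X ⊥ ≤-refl

  -- For nonempty X′, (b + 1) |X′| ≤ |X| + b is the same as (b + 1) (|X′| - 1) ≤ |X| - 1. Counting
  -- sizes minus one, no rounding errors accumulate over the stages.
  wins⇒small : ∀ s X → Wins s X → ∃[ Y ] P Y × suc b ^ s * pred ∣ Y ∣ ≤ pred ∣ X ∣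
  wins⇒small zero X PX = X , PX , ≤-reflexive (+-identityʳ _)
  wins⇒small (suc s) X strategy with greedyBreaker strategy
  ... | X′ , wins , ∣X′∣≤ with wins⇒small s X′ wins
  ...   | Y , PY , bound = Y , PY , (begin
    suc b * suc b ^ s * pred ∣ Y ∣   ≡⟨ *-assoc (suc b) (suc b ^ s) _ ⟩
    suc b * (suc b ^ s * pred ∣ Y ∣) ≤⟨ *-monoʳ-≤ (suc b) bound ⟩
    suc b * pred ∣ X′ ∣              ≤⟨ shrink ∣ X′ ∣ ∣ X ∣ (≤-trans ∣X′∣≤ (≤-reflexive
                                          (trans (cong (λ k → suc b * k + (∣ X ∣ + b)) (∣⊥∣≡0 m)) (cong (_+ (∣ X ∣ + b)) (*-zeroʳ (suc b)))))) ⟩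
    pred ∣ X ∣                       ∎)
    where
    open ≤-Reasoning
    shrink : ∀ y x → suc b * y ≤ x + b → suc b * pred y ≤ pred x
    shrink zero    x _ = ≤-trans (≤-reflexive (*-zeroʳ (suc b))) z≤n
    shrink (suc y) zero bound = contradiction bound (<⇒≱ (≤-trans (≤-reflexive (sym (cong suc (+-identityʳ b)))) (subst (suc (b + 0) ≤_) (sym (*-suc (suc b) y)) (s≤s (+-monoʳ-≤ b z≤n)))))
    shrink (suc y) (suc x) bound = +-cancelˡ-≤ (suc b) _ _ (begin
      suc b + suc b * y ≡⟨ *-suc (suc b) y ⟨
      suc b * suc y     ≤⟨ bound ⟩
      suc x + b         ≡⟨ cong suc (+-comm x b) ⟩
      suc b + x         ∎)

  module _ {W : Subset m → Set} (extract : ∀ X → P X → ∃[ F ] W F × F ⊆ X) where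

    -- The invariant is that no winning set inside the current board has been lost from `𝓕`; the
    -- converse below carries the opposite inclusion.
    wins⇒survives : ∀ s X 𝓕 → (∀ F → W F → F ⊆ X → 𝓕 F) → Wins s X → Survives b s X 𝓕
    wins⇒survives zero X 𝓕 keep PX with extract X PX
    ... | F , WF , F⊆X = F , keep F WF F⊆X
    wins⇒survives (suc s) X 𝓕 keep strategy = mapGoal
      (λ {X′} X′⊆ → wins⇒survives s X′ _ λ F WF F⊆X′ →
        keep F WF (λ e∈F → board (X′⊆ (F⊆X′ e∈F))) , F⊆X′) strategy
      where
      board : ∀ {e} → e ∈ X ∪ ⊥ → e ∈ X
      board e∈ with x∈p∪q⁻ X ⊥ e∈
      ... | inj₁ e∈X = e∈X
      ... | inj₂ e∈⊥ = contradiction e∈⊥ ∉⊥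

  module _ {W : Subset m → Set} (contain : ∀ {F X} → W F → F ⊆ X → P X) where

    survives⇒wins : ∀ s X 𝓕 → (∀ F → 𝓕 F → W F × F ⊆ X) → Survives b s X 𝓕 → Wins s X
    survives⇒wins zero X 𝓕 sound (F , 𝓕F) = let WF , F⊆X = sound F 𝓕F in contain WF F⊆X
    survives⇒wins (suc s) X 𝓕 sound = mapGoal λ {X′} _ →
      survives⇒wins s X′ _ λ F (𝓕F , F⊆X′) → proj₁ (sound F 𝓕F) , F⊆X′

-- Connectivity and cuts in K_n

nonempty⇒1≤∣p∣ : ∀ {m} {p : Subset m} → Nonempty p → 1 ≤ ∣ p ∣
nonempty⇒1≤∣p∣ (x , x∈p) = ≤-<-trans z≤n (x∈p⇒∣p-x∣<∣p∣ x∈p)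

1≤∣p∣⇒nonempty : ∀ {m} (p : Subset m) → 1 ≤ ∣ p ∣ → Nonempty p
1≤∣p∣⇒nonempty {m} p 1≤∣p∣ with nonempty? p
... | yes nonempty = nonempty
... | no  empty    =
  contradiction (subst (1 ≤_) (trans (cong ∣_∣ (Empty-unique empty)) (∣⊥∣≡0 m)) 1≤∣p∣) λ ()

module _ {n : ℕ} {X : EdgeSet n} where

  adjacent-sym : ∀ {u v} → Adjacent n X u v → Adjacent n X v u
  adjacent-sym (e , e∈X , ends) = e , e∈X , Sum.swap ends

  Leaves : Subset n → Set
  Leaves A = ∃[ v ] ∃[ w ] v ∈ A × w ∉ A × Adjacent n X v w

  leaves? : Decidable Leaves
  leaves? A = map′ to from (Fin.any? λ e → e ∈? X ×-dec (crosses? (ends e) ⊎-dec crosses? (Product.swap (ends e))))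
    where
    ends = List.lookup (edges n)
    Crosses : Fin n × Fin n → Set
    Crosses (v , w) = v ∈ A × w ∉ A
    crosses? : Decidable Crosses
    crosses? (v , w) = v ∈? A ×-dec ¬? (w ∈? A)
    to : ∃[ e ] e ∈ X × (Crosses (ends e) ⊎ Crosses (Product.swap (ends e))) → Leaves A
    to (e , e∈X , inj₁ (v∈A , w∉A)) = _ , _ , v∈A , w∉A , e , e∈X , inj₁ refl
    to (e , e∈X , inj₂ (v∈A , w∉A)) = _ , _ , v∈A , w∉A , e , e∈X , inj₂ refl
    from : Leaves A → ∃[ e ] e ∈ X × (Crosses (ends e) ⊎ Crosses (Product.swap (ends e)))
    from (v , w , v∈A , w∉A , e , e∈X , inj₁ eq) = e , e∈X , inj₁ (subst Crosses (sym eq) (v∈A , w∉A))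
    from (v , w , v∈A , w∉A , e , e∈X , inj₂ eq) =
      e , e∈X , inj₂ (subst (Crosses ∘ Product.swap) (sym eq) (v∈A , w∉A))

  -- As long as an edge leaves the set, its other end is added, at most n times in all. Building the
  -- component as a finite set makes reachability decidable and yields the cut criterion for
  -- connectivity.
  component : ∀ u → ∃[ C ] u ∈ C × (∀ {v} → v ∈ C → Star (Adjacent n X) u v) × ¬ Leaves C
  component u = grow n ⁅ u ⁆ (m≤n+m n _) (x∈⁅x⁆ u) λ v∈ → subst (Star _ u) (sym (x∈⁅y⁆⇒x≡y u v∈)) ε
    where
    grow : ∀ fuel A → n ≤ ∣ A ∣ + fuel → u ∈ A → (∀ {v} → v ∈ A → Star (Adjacent n X) u v) →
           ∃[ C ] u ∈ C × (∀ {v} → v ∈ C → Star (Adjacent n X) u v) × ¬ Leaves C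
    grow fuel A n≤ u∈A reach with leaves? A
    ... | no ¬leaves = A , u∈A , reach , ¬leaves
    grow zero A n≤ u∈A reach | yes (v , w , v∈A , w∉A , _) = contradiction
      (subst (w ∈_) (sym (∣p∣≡n⇒p≡⊤ (≤-antisym (∣p∣≤n A) (≤-trans n≤ (≤-reflexive (+-identityʳ _)))))) ∈⊤) w∉A
    grow (suc fuel) A n≤ u∈A reach | yes (v , w , v∈A , w∉A , adj) =
      grow fuel (A ∪ ⁅ w ⁆)
        (≤-trans n≤ (≤-trans (≤-reflexive (+-suc ∣ A ∣ fuel)) (+-monoˡ-≤ fuel
          (p⊂q⇒∣p∣<∣q∣ (p⊆p∪q ⁅ w ⁆ , w , q⊆p∪q A ⁅ w ⁆ (x∈⁅x⁆ w) , w∉A)))))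
        (p⊆p∪q ⁅ w ⁆ u∈A) reach′
      where
      reach′ : ∀ {x} → x ∈ A ∪ ⁅ w ⁆ → Star (Adjacent n X) u x
      reach′ x∈ with x∈p∪q⁻ A ⁅ w ⁆ x∈
      ... | inj₁ x∈A = reach x∈A
      ... | inj₂ x∈w = subst (Star _ u) (sym (x∈⁅y⁆⇒x≡y w x∈w)) (reach v∈A ◅◅ return adj)

  ¬leaves⇒closed : ∀ {C u v} → ¬ Leaves C → u ∈ C → Star (Adjacent n X) u v → v ∈ C
  ¬leaves⇒closed ¬leaves u∈C ε = u∈C
  ¬leaves⇒closed {C} ¬leaves u∈C (_◅_ {j = w} adj path) with w ∈? C
  ... | yes w∈C = ¬leaves⇒closed ¬leaves w∈C path
  ... | no  w∉C = contradiction (_ , _ , u∈C , w∉C , adj) ¬leaves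

  leaves⇒connected : (∀ A → Nonempty A → Nonempty (∁ A) → Leaves A) → Connected n X
  leaves⇒connected leaves u v with component u
  ... | C , u∈C , reach , ¬leaves with v ∈? C
  ...   | yes v∈C = reach v∈C
  ...   | no  v∉C = contradiction (leaves C (u , u∈C) (v , x∉p⇒x∈∁p v∉C)) ¬leaves

connected? : ∀ n → Decidable (Connected n)
connected? n X = Fin.all? λ u → Fin.all? (reachable? u)
  where
  reachable? : ∀ u v → Dec (Star (Adjacent n X) u v)
  reachable? u v with component {n} {X} u
  ... | C , u∈C , reach , ¬leaves = map′ reach (¬leaves⇒closed ¬leaves u∈C) (v ∈? C)

connected-mono : ∀ {n} {F X : EdgeSet n} → F ⊆ X → Connected n F → Connected n X
connected-mono F⊆X connected u v = Star.map (λ (e , e∈F , ends) → e , F⊆X e∈F , ends) (connected u v)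

-- Pruning a connected edge set to a spanning tree

module _ {n : ℕ} {T : EdgeSet n} {e : Fin (length (edges n))} {v w : Fin n}
         (vw : List.lookup (edges n) e ≡ (v , w) ⊎ List.lookup (edges n) e ≡ (w , v)) where

  adjacent-avoiding : ∀ {x y} → x ≢ v → x ≢ w → Adjacent n T x y → Adjacent n (T - e) x y
  adjacent-avoiding {x} {y} x≢v x≢w (e′ , e′∈T , xy) =
    e′ , x∈p∧x≢y⇒x∈p-y e′∈T (λ { refl → distinct vw xy }) , xy
    where
    Joins : Fin n → Fin n → Set
    Joins s t = List.lookup (edges n) e ≡ (s , t) ⊎ List.lookup (edges n) e ≡ (t , s)
    distinct : Joins v w → ¬ Joins x y
    distinct (inj₁ p) (inj₁ q) = x≢v (cong proj₁ (trans (sym q) p))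
    distinct (inj₁ p) (inj₂ q) = x≢w (cong proj₂ (trans (sym q) p))
    distinct (inj₂ p) (inj₁ q) = x≢w (cong proj₁ (trans (sym q) p))
    distinct (inj₂ p) (inj₂ q) = x≢v (cong proj₂ (trans (sym q) p))

  walk-avoiding : ∀ x xs → All (λ y → v ≢ y × w ≢ y) (x ∷ xs) → Linked (Adjacent n T) (x ∷ xs ++ v ∷ []) →
                  Star (Adjacent n (T - e)) x v
  walk-avoiding x [] ((v≢x , w≢x) ∷ []) (adj ∷ [-]) = return (adjacent-avoiding (v≢x ∘ sym) (w≢x ∘ sym) adj)
  walk-avoiding x (y ∷ ys) ((v≢x , w≢x) ∷ avoid) (adj ∷ walk) =
    adjacent-avoiding (v≢x ∘ sym) (w≢x ∘ sym) adj ◅ walk-avoiding y ys avoid walk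

  detour : Star (Adjacent n (T - e)) v w → Connected n T → Connected n (T - e)
  detour path connected x y = (step ⋆) (connected x y)
    where
    step : ∀ {x y} → Adjacent n T x y → Star (Adjacent n (T - e)) x y
    step (e′ , e′∈T , xy) with e′ Fin.≟ e
    ... | no e′≢e = return (e′ , x∈p∧x≢y⇒x∈p-y e′∈T e′≢e , xy)
    ... | yes refl = along xy vw
      where
      along : ∀ {x y} → List.lookup (edges n) e ≡ (x , y) ⊎ List.lookup (edges n) e ≡ (y , x) →
              List.lookup (edges n) e ≡ (v , w) ⊎ List.lookup (edges n) e ≡ (w , v) →
              Star (Adjacent n (T - e)) x y
      along (inj₁ p) (inj₁ q) with refl ← trans (sym p) q = path
      along (inj₁ p) (inj₂ q) with refl ← trans (sym p) q = reverse adjacent-sym path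
      along (inj₂ p) (inj₁ q) with refl ← trans (sym p) q = reverse adjacent-sym path
      along (inj₂ p) (inj₂ q) with refl ← trans (sym p) q = path

-- The first edge of a cycle could be deleted: the rest of the cycle joins its ends, so every path
-- through the edge can be rerouted.
minimal⇒acyclic : ∀ {n} {T : EdgeSet n} → Connected n T → (∀ e → e ∈ T → ¬ Connected n (T - e)) → ¬ Cycle n T
minimal⇒acyclic connected minimal (v , [] , () , _)
minimal⇒acyclic connected minimal (v , _ ∷ [] , s≤s () , _)
minimal⇒acyclic {n} {T} connected minimal
  (v , w ∷ x ∷ xs , _ , ((v≢w ∷ v≢xs) ∷ w≢xs ∷ _) , ((e , e∈T , vw) ∷ wx ∷ walk)) =
  minimal e e∈T (detour vw (reverse adjacent-sym (wx′ ◅ walk-avoiding vw x xs avoid walk)) connected)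
  where
  avoid = All.zip (v≢xs , w≢xs)
  -- `w` is an end of the deleted edge, so the step from `w` to `x` is treated from its other end
  -- `x`.
  wx′ = adjacent-sym (adjacent-avoiding vw
          (proj₁ (All.head avoid) ∘ sym) (proj₂ (All.head avoid) ∘ sym) (adjacent-sym wx))

spanningTree : ∀ {n} (X : EdgeSet n) → Connected n X → ∃[ T ] IsSpanningTree n T × T ⊆ X
spanningTree {n} X = prune ∣ X ∣ X ≤-refl
  where
  prune : ∀ fuel X → ∣ X ∣ ≤ fuel → Connected n X → ∃[ T ] IsSpanningTree n T × T ⊆ X
  prune fuel X ∣X∣≤ connected with Fin.any? (λ e → e ∈? X ×-dec connected? n (X - e))
  ... | no minimal = X , (connected , minimal⇒acyclic connected λ e e∈X c → minimal (e , e∈X , c)) , λ e∈ → e∈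
  prune zero X ∣X∣≤ connected | yes (e , e∈X , _) =
    contradiction ∣X∣≤ (<⇒≱ (≤-<-trans z≤n (x∈p⇒∣p-x∣<∣p∣ e∈X)))
  prune (suc fuel) X ∣X∣≤ connected | yes (e , e∈X , connected′)
    with prune fuel (X - e) (≤-pred (≤-trans (x∈p⇒∣p-x∣<∣p∣ e∈X) ∣X∣≤)) connected′
  ... | T , tree , T⊆ = T , tree , λ f∈T → p─q⊆p X ⁅ e ⁆ (T⊆ f∈T)

endpoints : ∀ {n} (es : List (Fin n × Fin n)) → Subset (length es) → Subset n
endpoints []             []            = ⊥
endpoints ((v , w) ∷ es) (inside ∷ X)  = (⁅ v ⁆ ∪ ⁅ w ⁆) ∪ endpoints es X
endpoints ((v , w) ∷ es) (outside ∷ X) = endpoints es X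

∣endpoints∣≤ : ∀ {n} (es : List (Fin n × Fin n)) X → ∣ endpoints es X ∣ ≤ 2 * ∣ X ∣
∣endpoints∣≤ {n} [] [] = ≤-reflexive (∣⊥∣≡0 n)
∣endpoints∣≤ ((v , w) ∷ es) (outside ∷ X) = ∣endpoints∣≤ es X
∣endpoints∣≤ ((v , w) ∷ es) (inside ∷ X) = begin
  ∣ (⁅ v ⁆ ∪ ⁅ w ⁆) ∪ endpoints es X ∣      ≤⟨ ∣p∪q∣≤∣p∣+∣q∣ (⁅ v ⁆ ∪ ⁅ w ⁆) _ ⟩
  ∣ ⁅ v ⁆ ∪ ⁅ w ⁆ ∣ + ∣ endpoints es X ∣    ≤⟨ +-mono-≤ (∣p∪q∣≤∣p∣+∣q∣ ⁅ v ⁆ ⁅ w ⁆) (∣endpoints∣≤ es X) ⟩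
  ∣ ⁅ v ⁆ ∣ + ∣ ⁅ w ⁆ ∣ + 2 * ∣ X ∣         ≡⟨ cong₂ (λ a c → a + c + 2 * ∣ X ∣) (∣⁅x⁆∣≡1 v) (∣⁅x⁆∣≡1 w) ⟩
  2 + 2 * ∣ X ∣                             ≡⟨ *-suc 2 ∣ X ∣ ⟨
  2 * suc ∣ X ∣                             ∎
  where open ≤-Reasoning

∈endpoints : ∀ {n} (es : List (Fin n × Fin n)) X e {v w} → e ∈ X →
  List.lookup es e ≡ (v , w) ⊎ List.lookup es e ≡ (w , v) → v ∈ endpoints es X
∈endpoints ((v , w) ∷ es) (inside ∷ X) zero here (inj₁ refl) = p⊆p∪q _ (p⊆p∪q ⁅ w ⁆ (x∈⁅x⁆ v))
∈endpoints ((v , w) ∷ es) (inside ∷ X) zero here (inj₂ refl) = p⊆p∪q _ (q⊆p∪q ⁅ v ⁆ ⁅ w ⁆ (x∈⁅x⁆ w))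
∈endpoints ((v , w) ∷ es) (inside ∷ X) (suc e) (there e∈X) ends =
  q⊆p∪q (⁅ v ⁆ ∪ ⁅ w ⁆) _ (∈endpoints es X e e∈X ends)
∈endpoints (_ ∷ es) (outside ∷ X) (suc e) (there e∈X) ends = ∈endpoints es X e e∈X ends

another : ∀ {n} → 2 ≤ n → (v : Fin n) → ∃[ w ] v ≢ w
another (s≤s (s≤s _)) zero    = suc zero , λ ()
another (s≤s (s≤s _)) (suc v) = zero , λ ()

-- Each vertex lies on the first edge of a path to some other vertex, and an edge touches only two.
-- This is weaker than n - 1 edges, but constant factors vanish in the asymptotics.
connected⇒n≤2∣X∣ : ∀ {n} {X : EdgeSet n} → 2 ≤ n → Connected n X → n ≤ 2 * ∣ X ∣
connected⇒n≤2∣X∣ {n} {X} 2≤n connected = begin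
  n                             ≡⟨ ∣⊤∣≡n n ⟨
  ∣ ⊤ {n} ∣                     ≤⟨ p⊆q⇒∣p∣≤∣q∣ {p = ⊤} (λ {v} _ → touched v) ⟩
  ∣ endpoints (edges n) X ∣     ≤⟨ ∣endpoints∣≤ (edges n) X ⟩
  2 * ∣ X ∣                     ∎
  where
  open ≤-Reasoning
  touched : ∀ v → v ∈ endpoints (edges n) X
  touched v with another 2≤n v
  ... | w , v≢w with connected v w
  ...   | ε = contradiction refl v≢w
  ...   | (e , e∈X , ends) ◅ _ = ∈endpoints (edges n) X e e∈X ends

length-cartesianProduct : ∀ {A B : Set} (xs : List A) (ys : List B) →
  length (cartesianProduct xs ys) ≡ length xs * length ys
length-cartesianProduct []       ys = refl
length-cartesianProduct (x ∷ xs) ys =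
  trans (length-++ (map (x ,_) ys)) (cong₂ _+_ (length-map (x ,_) ys) (length-cartesianProduct xs ys))

∣edges∣≤ : ∀ n → length (edges n) ≤ n * n
∣edges∣≤ n = ≤-trans (length-filter _ (cartesianProduct (allFin n) (allFin n)))
  (≤-reflexive (trans (length-cartesianProduct (allFin n) (allFin n))
    (cong₂ _*_ (length-tabulate {n = n} id) (length-tabulate {n = n} id))))

cut : ∀ {n} (es : List (Fin n × Fin n)) → Subset n → Subset (length es)
cut []             A = []
cut ((v , w) ∷ es) A = (lookup A v xor lookup A w) ∷ cut es A

∉⇒lookup≡outside : ∀ {n} {A : Subset n} {v} → lookup A v ≡ outside → v ∉ A
∉⇒lookup≡outside eq v∈A with () ← trans (sym eq) ([]=⇒lookup v∈A)

∈cut⇒crosses : ∀ {n} (es : List (Fin n × Fin n)) A e → e ∈ cut es A → let v , w = List.lookup es e in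
  (v ∈ A × w ∉ A) ⊎ (w ∈ A × v ∉ A)
∈cut⇒crosses ((v , w) ∷ es) A zero e∈ = split _ _ refl refl ([]=⇒lookup e∈)
  where
  split : ∀ a b → lookup A v ≡ a → lookup A w ≡ b → (lookup A v xor lookup A w) ≡ true →
          (v ∈ A × w ∉ A) ⊎ (w ∈ A × v ∉ A)
  split true true p q r rewrite p | q with () ← r
  split true false p q r = inj₁ (lookup⇒[]= v A p , ∉⇒lookup≡outside q)
  split false true p q r = inj₂ (lookup⇒[]= w A q , ∉⇒lookup≡outside p)
  split false false p q r rewrite p | q with () ← r
∈cut⇒crosses (_ ∷ es) A (suc e) (there e∈) = ∈cut⇒crosses es A e e∈

-- Maker's invariant speaks of sets with at most n/2 vertices; this symmetry extends its use to the
-- larger ones.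
cut-∁ : ∀ {n} (es : List (Fin n × Fin n)) A → cut es (∁ A) ≡ cut es A
cut-∁ [] A = refl
cut-∁ ((v , w) ∷ es) A = cong₂ _∷_
  (trans (cong₂ _xor_ (lookup-map v not A) (lookup-map w not A)) (not-xor-not (lookup A v) (lookup A w)))
  (cut-∁ es A)
  where
  not-xor-not : ∀ a b → not a xor not b ≡ a xor b
  not-xor-not true  true  = refl
  not-xor-not true  false = refl
  not-xor-not false true  = refl
  not-xor-not false false = refl

cut-nonempty⇒leaves : ∀ {n} {X : EdgeSet n} A → Nonempty (cut (edges n) A ∩ X) → Leaves {n} {X} A
cut-nonempty⇒leaves {n} {X} A (e , e∈) with x∈p∩q⁻ (cut (edges n) A) X e∈
... | e∈cut , e∈X with ∈cut⇒crosses (edges n) A e e∈cut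
...   | inj₁ (v∈A , w∉A) = _ , _ , v∈A , w∉A , e , e∈X , inj₁ refl
...   | inj₂ (w∈A , v∉A) = _ , _ , w∈A , v∉A , e , e∈X , inj₂ refl

-- Counting the edges of a cut

bit : Bool → ℕ
bit b = if b then 1 else 0

∑ : ∀ {A : Set} → List A → (A → ℕ) → ℕ
∑ xs f = sum (map f xs)

module _ {A : Set} where

  ∑-cong : ∀ (xs : List A) {f g : A → ℕ} → (∀ x → f x ≡ g x) → ∑ xs f ≡ ∑ xs g
  ∑-cong xs f≡g = cong sum (map-cong f≡g xs)

  ∑-mono-≤ : ∀ (xs : List A) {f g : A → ℕ} → (∀ x → f x ≤ g x) → ∑ xs f ≤ ∑ xs g
  ∑-mono-≤ []       f≤g = z≤n
  ∑-mono-≤ (x ∷ xs) f≤g = +-mono-≤ (f≤g x) (∑-mono-≤ xs f≤g)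

  ∑-+ : ∀ (xs : List A) f g → ∑ xs (λ x → f x + g x) ≡ ∑ xs f + ∑ xs g
  ∑-+ []       f g = refl
  ∑-+ (x ∷ xs) f g rewrite ∑-+ xs f g = interchange (f x) (g x) (∑ xs f) (∑ xs g)
    where
    interchange : ∀ a b c d → (a + b) + (c + d) ≡ (a + c) + (b + d)
    interchange = solve-∀

  ∑-*ˡ : ∀ (xs : List A) k f → ∑ xs (λ x → k * f x) ≡ k * ∑ xs f
  ∑-*ˡ []       k f = sym (*-zeroʳ k)
  ∑-*ˡ (x ∷ xs) k f = trans (cong (k * f x +_) (∑-*ˡ xs k f)) (sym (*-distribˡ-+ k (f x) _))

  ∑-*ʳ : ∀ (xs : List A) k f → ∑ xs (λ x → f x * k) ≡ ∑ xs f * k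
  ∑-*ʳ []       k f = refl
  ∑-*ʳ (x ∷ xs) k f = trans (cong (f x * k +_) (∑-*ʳ xs k f)) (sym (*-distribʳ-+ k (f x) _))

module _ {A : Set} where

  ∑-swap : ∀ {B : Set} (xs : List A) (ys : List B) (f : A → B → ℕ) →
    ∑ xs (λ x → ∑ ys (f x)) ≡ ∑ ys (λ y → ∑ xs (λ x → f x y))
  ∑-swap []       []       f = refl
  ∑-swap []       (y ∷ ys) f = ∑-swap [] ys f
  ∑-swap (x ∷ xs) ys       f =
    trans (cong (∑ ys (f x) +_) (∑-swap xs ys f)) (sym (∑-+ ys (f x) _))

  ∑-filter : ∀ {P : A → Set} (P? : Decidable P) xs f →
    ∑ (filter P? xs) f ≡ ∑ xs (λ x → bit (does (P? x)) * f x)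
  ∑-filter P? []       f = refl
  ∑-filter P? (x ∷ xs) f with does (P? x)
  ... | true  = cong₂ _+_ (sym (+-identityʳ (f x))) (∑-filter P? xs f)
  ... | false = ∑-filter P? xs f

  ∑-cartesianProduct : ∀ {B : Set} (xs : List A) (ys : List B) f →
    ∑ (cartesianProduct xs ys) f ≡ ∑ xs (λ x → ∑ ys (λ y → f (x , y)))
  ∑-cartesianProduct []       ys f = refl
  ∑-cartesianProduct (x ∷ xs) ys f = begin
    sum (map f (map (x ,_) ys ++ cartesianProduct xs ys))
      ≡⟨ cong sum (map-++ f (map (x ,_) ys) _) ⟩
    sum (map f (map (x ,_) ys) ++ map f (cartesianProduct xs ys))
      ≡⟨ sum-++ (map f (map (x ,_) ys)) _ ⟩
    ∑ (map (x ,_) ys) f + ∑ (cartesianProduct xs ys) f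
      ≡⟨ cong₂ _+_ (cong sum (sym (map-∘ ys))) (∑-cartesianProduct xs ys f) ⟩
    ∑ ys (λ y → f (x , y)) + ∑ xs (λ x → ∑ ys (λ y → f (x , y))) ∎
    where open ≡-Reasoning

∣∷∣ : ∀ {n} b (p : Subset n) → ∣ b ∷ p ∣ ≡ bit b + ∣ p ∣
∣∷∣ true  p = refl
∣∷∣ false p = refl

∣cut∣ : ∀ {n} (es : List (Fin n × Fin n)) A →
  ∣ cut es A ∣ ≡ ∑ es (λ (v , w) → bit (lookup A v xor lookup A w))
∣cut∣ []             A = refl
∣cut∣ ((v , w) ∷ es) A =
  trans (∣∷∣ (lookup A v xor lookup A w) (cut es A)) (cong (bit (lookup A v xor lookup A w) +_) (∣cut∣ es A))

∑-allFin : ∀ {n} (A : Subset n) → ∑ (allFin n) (bit ∘ lookup A) ≡ ∣ A ∣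
∑-allFin {n} A = trans (cong sum (map-tabulate id (bit ∘ lookup A))) (go A)
  where
  go : ∀ {n} (A : Subset n) → sum (tabulate (bit ∘ lookup A)) ≡ ∣ A ∣
  go []      = refl
  go (a ∷ A) = trans (cong (bit a +_) (go A)) (sym (∣∷∣ a A))

-- The left side counts ordered pairs (v , w) with v in A and w outside, whereas `edges` lists pairs
-- with v < w only. The pairs with w < v are transposed by exchanging the sums, and the two halves
-- recombine to `xor`.
∣A∣*∣∁A∣≤∣cut∣ : ∀ n (A : Subset n) → ∣ A ∣ * ∣ ∁ A ∣ ≤ ∣ cut (edges n) A ∣
∣A∣*∣∁A∣≤∣cut∣ n A = begin
  ∣ A ∣ * ∣ ∁ A ∣
    ≡⟨ cong₂ _*_ (∑-allFin A) (∑-allFin (∁ A)) ⟨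
  ∑ V (bit ∘ lookup A) * ∑ V (bit ∘ lookup (∁ A))
    ≡⟨ ∑-*ʳ V _ _ ⟨
  ∑ V (λ v → bit (lookup A v) * ∑ V (bit ∘ lookup (∁ A)))
    ≡⟨ ∑-cong V (λ v → trans (sym (∑-*ˡ V (bit (lookup A v)) _))
         (∑-cong V λ w → cong (λ a → bit (lookup A v) * bit a) (lookup-map w not A))) ⟩
  ∑ V (λ v → ∑ V (h v))
    ≤⟨ ∑-mono-≤ V (λ v → ∑-mono-≤ V (ordered v)) ⟩
  ∑ V (λ v → ∑ V (λ w → lt v w * h v w + lt w v * h v w))
    ≡⟨ ∑∑-+ (λ v w → lt v w * h v w) (λ v w → lt w v * h v w) ⟩
  ∑ V (λ v → ∑ V (λ w → lt v w * h v w)) + ∑ V (λ v → ∑ V (λ w → lt w v * h v w))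
    ≡⟨ cong (∑ V (λ v → ∑ V (λ w → lt v w * h v w)) +_) (∑-swap V V (λ v w → lt w v * h v w)) ⟩
  ∑ V (λ v → ∑ V (λ w → lt v w * h v w)) + ∑ V (λ w → ∑ V (λ v → lt w v * h v w))
    ≡⟨ ∑∑-+ (λ v w → lt v w * h v w) (λ v w → lt v w * h w v) ⟨
  ∑ V (λ v → ∑ V (λ w → lt v w * h v w + lt v w * h w v))
    ≡⟨ ∑-cong V (λ v → ∑-cong V λ w → trans (sym (*-distribˡ-+ (lt v w) _ _))
         (cong (lt v w *_) (symmetrise (lookup A v) (lookup A w)))) ⟩
  ∑ V (λ v → ∑ V (λ w → lt v w * bit (lookup A v xor lookup A w)))
    ≡⟨ ∑-cartesianProduct V V _ ⟨
  ∑ (cartesianProduct V V) (λ (v , w) → lt v w * bit (lookup A v xor lookup A w))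
    ≡⟨ ∑-filter (λ (v , w) → v Fin.<? w) (cartesianProduct V V) _ ⟨
  ∑ (edges n) (λ (v , w) → bit (lookup A v xor lookup A w))
    ≡⟨ ∣cut∣ (edges n) A ⟨
  ∣ cut (edges n) A ∣ ∎
  where
  open ≤-Reasoning
  V = allFin n
  h : Fin n → Fin n → ℕ
  h v w = bit (lookup A v) * bit (not (lookup A w))
  lt : Fin n → Fin n → ℕ
  lt v w = bit (does (v Fin.<? w))
  ∑∑-+ : ∀ (f g : Fin n → Fin n → ℕ) →
    ∑ V (λ v → ∑ V (λ w → f v w + g v w)) ≡ ∑ V (λ v → ∑ V (f v)) + ∑ V (λ v → ∑ V (g v))
  ∑∑-+ f g = trans (∑-cong V (λ v → ∑-+ V (f v) (g v))) (∑-+ V _ _)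
  ordered : ∀ v w → h v w ≤ lt v w * h v w + lt w v * h v w
  ordered v w = trichotomy (v Fin.<? w) (w Fin.<? v)
    where
    diagonal : ∀ a → bit a * bit (not a) ≡ 0
    diagonal true  = refl
    diagonal false = refl
    trichotomy : (v<w : Dec (v Fin.< w)) (w<v : Dec (w Fin.< v)) →
              h v w ≤ bit (does v<w) * h v w + bit (does w<v) * h v w
    trichotomy (yes _)  _        = ≤-trans (m≤m+n (h v w) 0) (m≤m+n (h v w + 0) _)
    trichotomy (no _)   (yes _)  = m≤m+n (h v w) 0
    -- The diagonal v = w contributes nothing, as a vertex is not on both sides.
    trichotomy (no v≮w) (no w≮v) with refl ← Fin.toℕ-injective (≤-antisym (≮⇒≥ w≮v) (≮⇒≥ v≮w)) =
      ≤-reflexive (diagonal (lookup A v))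
  symmetrise : ∀ a b → bit a * bit (not b) + bit b * bit (not a) ≡ bit (a xor b)
  symmetrise true  true  = refl
  symmetrise true  false = refl
  symmetrise false true  = refl
  symmetrise false false = refl

connected-⊤ : ∀ n → Connected n ⊤
connected-⊤ n = leaves⇒connected λ A nonempty nonempty∁ → cut-nonempty⇒leaves A
  (1≤∣p∣⇒nonempty (cut (edges n) A ∩ ⊤) (begin
    1                               ≤⟨ *-mono-≤ (nonempty⇒1≤∣p∣ nonempty) (nonempty⇒1≤∣p∣ nonempty∁) ⟩
    ∣ A ∣ * ∣ ∁ A ∣                 ≤⟨ ∣A∣*∣∁A∣≤∣cut∣ n A ⟩
    ∣ cut (edges n) A ∣             ≡⟨ cong ∣_∣ (∩-identityʳ (cut (edges n) A)) ⟨
    ∣ cut (edges n) A ∩ ⊤ ∣         ∎))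
  where open ≤-Reasoning

-- Estimates for the potential

-- Bernoulli's inequality (1 - 1/(w+1))^i ≥ 1 - i/w without denominators.
bernoulli-upper : ∀ i u w → i + u ≡ w → suc w ^ i * u ≤ w ^ suc i
bernoulli-upper zero u .u refl = ≤-reflexive (*-comm 1 u)
bernoulli-upper (suc i) u w i+u≡w = begin
  suc w * suc w ^ i * u     ≡⟨ e (suc w) (suc w ^ i) u ⟩
  suc w ^ i * (suc w * u)   ≤⟨ *-monoʳ-≤ (suc w ^ i) (+-monoˡ-≤ (w * u) u≤w) ⟩
  suc w ^ i * (w + w * u)   ≡⟨ cong (suc w ^ i *_) (*-suc w u) ⟨
  suc w ^ i * (w * suc u)   ≡⟨ e′ (suc w ^ i) w (suc u) ⟩
  w * (suc w ^ i * suc u)   ≤⟨ *-monoʳ-≤ w (bernoulli-upper i (suc u) w (trans (+-suc i u) i+u≡w)) ⟩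
  w * w ^ suc i             ∎
  where
  open ≤-Reasoning
  u≤w : u ≤ w
  u≤w = subst (u ≤_) i+u≡w (m≤n+m u (suc i))
  e : ∀ a p u → a * p * u ≡ p * (a * u)
  e = solve-∀
  e′ : ∀ p w u → p * (w * u) ≡ w * (p * u)
  e′ = solve-∀

-- With u = w - i ≥ w / 2, Bernoulli gives (1 + 1/w)^i ≤ w / u ≤ 2. Used for the initial potential
-- (w = 2n, i = n) and for the overhead of all stages (w = R β, i = R).
[1+w]^i≤2w^i : ∀ i w → 1 ≤ i → 2 * i ≤ w → suc w ^ i ≤ 2 * w ^ i
[1+w]^i≤2w^i i w 1≤i 2i≤w with m≤n⇒∃[o]m+o≡n (≤-trans (m≤m+n i (i + 0)) 2i≤w)
... | u , i+u≡w = *-cancelʳ-≤ _ _ u {{>-nonZero (≤-trans 1≤i i≤u)}} (begin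
  suc w ^ i * u      ≤⟨ bernoulli-upper i u w i+u≡w ⟩
  w * w ^ i          ≤⟨ *-monoˡ-≤ (w ^ i) w≤2u ⟩
  2 * u * w ^ i      ≡⟨ e u (w ^ i) ⟩
  2 * w ^ i * u      ∎)
  where
  open ≤-Reasoning
  i≤u : i ≤ u
  i≤u = +-cancelˡ-≤ i i u (≤-trans (≤-reflexive (cong (i +_) (sym (+-identityʳ i)))) (≤-trans 2i≤w (≤-reflexive (sym i+u≡w))))
  w≤2u : w ≤ 2 * u
  w≤2u = ≤-trans (≤-reflexive (sym i+u≡w)) (+-mono-≤ i≤u (≤-reflexive (sym (+-identityʳ u))))
  e : ∀ u p → 2 * u * p ≡ 2 * p * u
  e = solve-∀

bernoulli-lower : ∀ i w → w ^ suc i + i * w ^ i ≤ w * suc w ^ i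
bernoulli-lower zero w = ≤-reflexive (+-identityʳ _)
bernoulli-lower (suc i) w = begin
  w * (w * w ^ i) + suc i * (w * w ^ i)                ≤⟨ m≤m+n _ (i * w ^ i) ⟩
  w * (w * w ^ i) + suc i * (w * w ^ i) + i * w ^ i    ≡⟨ e w i (w ^ i) ⟩
  suc w * (w * w ^ i + i * w ^ i)                      ≤⟨ *-monoʳ-≤ (suc w) (bernoulli-lower i w) ⟩
  suc w * (w * suc w ^ i)                              ≡⟨ e′ (suc w) w (suc w ^ i) ⟩
  w * (suc w * suc w ^ i)                              ∎
  where
  open ≤-Reasoning
  e : ∀ w i p → w * (w * p) + suc i * (w * p) + i * p ≡ suc w * (w * p + i * p)
  e = solve-∀
  e′ : ∀ a b c → a * (b * c) ≡ b * (a * c)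
  e′ = solve-∀

-- Converts powers of θ = 1 + 1/N into powers of two: N factors θ are worth at least one factor 2.
2w^w≤[1+w]^w : ∀ w .{{_ : NonZero w}} → 2 * w ^ w ≤ suc w ^ w
2w^w≤[1+w]^w w = *-cancelˡ-≤ w (≤-trans (≤-reflexive (e w (w ^ w))) (bernoulli-lower w w))
  where
  e : ∀ w p → w * (2 * p) ≡ w * p + w * p
  e = solve-∀

≤-by : ∀ {m n} d → m + d ≡ n → m ≤ n
≤-by {m} d refl = m≤m+n m d

square-bound : ∀ h v d j P → h * v ≤ j * d → j * j * P ≤ v * v → .{{NonZero v}} → P * (h * h) ≤ d * d
square-bound h v d j P hv≤jd j²P≤v² = *-cancelˡ-≤ (v * v) {{m*n≢0 v v}} (begin
  v * v * (P * (h * h))       ≡⟨ e v P h ⟩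
  P * ((h * v) * (h * v))     ≤⟨ *-monoʳ-≤ P (*-mono-≤ hv≤jd hv≤jd) ⟩
  P * ((j * d) * (j * d))     ≡⟨ e′ P j d ⟩
  j * j * P * (d * d)         ≤⟨ *-monoˡ-≤ (d * d) j²P≤v² ⟩
  v * v * (d * d)             ∎)
  where
  open ≤-Reasoning
  e : ∀ v P h → v * v * (P * (h * h)) ≡ P * ((h * v) * (h * v))
  e = solve-∀
  e′ : ∀ P j d → P * ((j * d) * (j * d)) ≡ j * j * P * (d * d)
  e′ = solve-∀

-- θ^j + θ^-(j+1) ≤ 2 for θ = 1 + 1/(j+1)², without denominators.
two-sided : ∀ j → let N = suc j * suc j; P = suc N in
  P ^ suc j * P ^ j + N ^ j * N ^ suc j ≤ 2 * (P ^ suc j * N ^ j)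
two-sided j with m≤n⇒∃[o]m+o≡n (^-monoˡ-≤ j (n≤1+n (suc j * suc j)))
-- Put d = N^j and h = P^j - N^j. As P = N + 1, the right side minus the left side is d² - P h², so
-- P h² ≤ d² is what remains.
... | h , d+h≡a = ≤-trans (≤-reflexive (cong₂ (λ x y → x + N ^ j * (N * y)) (cong (λ y → P * y * y) (sym d+h≡a)) refl))
    (≤-trans (+-cancelˡ-≤ (P * (h * h) + d * d) _ _ (begin
      (P * (h * h) + d * d) + (P * (d + h) * (d + h) + d * (N * d)) ≡⟨ e N d h ⟩
      P * (h * h) + (P * (h * h) + 2 * (P * (d + h) * d))
        ≤⟨ +-monoʳ-≤ (P * (h * h)) (+-monoˡ-≤ _ Ph²≤d²) ⟩
      P * (h * h) + (d * d + 2 * (P * (d + h) * d))                ≡⟨ +-assoc (P * (h * h)) (d * d) _ ⟨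
      (P * (h * h) + d * d) + 2 * (P * (d + h) * d)                ∎))
     (≤-reflexive (cong (λ y → 2 * (P * y * d)) d+h≡a)))
  where
  open ≤-Reasoning
  N = suc j * suc j
  P = suc N
  d = N ^ j
  -- This is N - j, so that Bernoulli bounds h / d by j / v. For N = (j + 1)² one has v² = j² P + (j
  -- + 1)², which gives P h² ≤ d².
  v = suc (j * j + j)
  hv≤jd : h * v ≤ j * d
  hv≤jd = +-cancelˡ-≤ (d * v) _ _ (begin
    d * v + h * v   ≡⟨ *-distribʳ-+ v d h ⟨
    (d + h) * v     ≡⟨ cong (_* v) d+h≡a ⟩
    P ^ j * v       ≤⟨ bernoulli-upper j v N (j+v≡N j) ⟩
    N * d           ≡⟨ e₁ j d ⟩
    d * v + j * d   ∎)
    where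
    j+v≡N : ∀ j → j + suc (j * j + j) ≡ suc j * suc j
    j+v≡N = solve-∀
    e₁ : ∀ j d → suc j * suc j * d ≡ d * suc (j * j + j) + j * d
    e₁ = solve-∀
  Ph²≤d² : P * (h * h) ≤ d * d
  Ph²≤d² = square-bound h v d j P hv≤jd (≤-by (j * j + 2 * j + 1) (e₂ j))
    where
    e₂ : ∀ j → j * j * suc (suc j * suc j) + (j * j + 2 * j + 1) ≡ suc (j * j + j) * suc (j * j + j)
    e₂ = solve-∀
  e : ∀ N d h → (suc N * (h * h) + d * d) + (suc N * (d + h) * (d + h) + d * (N * d))
              ≡ suc N * (h * h) + (suc N * (h * h) + 2 * (suc N * (d + h) * d))
  e = solve-∀

^-split : ∀ m a b c → m ^ ((a + b) * c) ≡ m ^ (a * c) * m ^ (b * c)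
^-split m a b c = trans (cong (m ^_) (*-distribʳ-+ c a b)) (^-distribˡ-+-* m (a * c) (b * c))

^-*-distribʳ : ∀ m n o → (m * n) ^ o ≡ m ^ o * n ^ o
^-*-distribʳ m n zero    = refl
^-*-distribʳ m n (suc o) = trans (cong (m * n *_) (^-*-distribʳ m n o)) (e m n (m ^ o) (n ^ o))
  where
  e : ∀ m n p q → m * n * (p * q) ≡ m * p * (n * q)
  e = solve-∀

module _ (γ : ℕ) where
  open Weight γ

  -- Elements outside `S` contribute γ each, so a factor γ^(m - |S|) is due on the left; multiplying
  -- both sides by γ^|S| avoids the subtraction.
  weight-final : ∀ {m} α β (S M : Subset m) g → (∀ e → α ≤ lookup g e) →
    (∀ {e} → e ∈ S → e ∉ M → β ≤ lookup g e) →
    α ^ ∣ S ∩ M ∣ * β ^ ∣ S ─ M ∣ * γ ^ m ≤ weight S g * γ ^ (∣ S ∩ M ∣ + ∣ S ─ M ∣)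
  weight-final α β [] [] [] α≤ β≤ = ≤-refl
  weight-final {suc m} α β (inside ∷ S) (inside ∷ M) (a ∷ g) α≤ β≤ = begin
    α * α ^ x * β ^ y * (γ * γ ^ m)             ≡⟨ e α γ (α ^ x) (β ^ y) (γ ^ m) ⟩
    α * γ * (α ^ x * β ^ y * γ ^ m)             ≤⟨ *-mono-≤ (*-monoˡ-≤ γ (α≤ zero)) (weight-final α β S M g (α≤ ∘ suc) λ e∈ e∉ → β≤ (there e∈) (e∉ ∘ drop-there)) ⟩
    a * γ * (weight S g * γ ^ (x + y))          ≡⟨ e′ a γ (weight S g) _ ⟩
    a * weight S g * (γ * γ ^ (x + y))          ∎
    where
    open ≤-Reasoning
    x = ∣ S ∩ M ∣
    y = ∣ S ─ M ∣
    e : ∀ α γ p q r → α * p * q * (γ * r) ≡ α * γ * (p * q * r)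
    e = solve-∀
    e′ : ∀ a γ w p → a * γ * (w * p) ≡ a * w * (γ * p)
    e′ = solve-∀
  weight-final {suc m} α β (inside ∷ S) (outside ∷ M) (a ∷ g) α≤ β≤ = begin
    α ^ x * (β * β ^ y) * (γ * γ ^ m)           ≡⟨ e β γ (α ^ x) (β ^ y) (γ ^ m) ⟩
    β * γ * (α ^ x * β ^ y * γ ^ m)             ≤⟨ *-mono-≤ (*-monoˡ-≤ γ (β≤ {zero} here λ ())) (weight-final α β S M g (α≤ ∘ suc) λ e∈ e∉ → β≤ (there e∈) (e∉ ∘ drop-there)) ⟩
    a * γ * (weight S g * γ ^ (x + y))          ≡⟨ e′ a γ (weight S g) _ ⟩
    a * weight S g * (γ * γ ^ (x + y))          ≡⟨ cong (λ k → a * weight S g * γ ^ k) (+-suc x y) ⟨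
    a * weight S g * γ ^ (x + suc y)            ∎
    where
    open ≤-Reasoning
    x = ∣ S ∩ M ∣
    y = ∣ S ─ M ∣
    e : ∀ β γ p q r → p * (β * q) * (γ * r) ≡ β * γ * (p * q * r)
    e = solve-∀
    e′ : ∀ a γ w p → a * γ * (w * p) ≡ a * w * (γ * p)
    e′ = solve-∀
  weight-final {suc m} α β (outside ∷ S) (s ∷ M) (a ∷ g) α≤ β≤ = begin
    α ^ x * β ^ y′ * (γ * γ ^ m)                ≡⟨ cong (λ y → α ^ x * β ^ y * (γ * γ ^ m)) (y′≡y s) ⟩
    α ^ x * β ^ y * (γ * γ ^ m)                 ≡⟨ e γ (α ^ x) (β ^ y) (γ ^ m) ⟩
    γ * (α ^ x * β ^ y * γ ^ m)                 ≤⟨ *-monoʳ-≤ γ (weight-final α β S M g (α≤ ∘ suc) λ e∈ e∉ → β≤ (there e∈) (e∉ ∘ drop-there)) ⟩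
    γ * (weight S g * γ ^ (x + y))              ≡⟨ *-assoc γ (weight S g) _ ⟨
    γ * weight S g * γ ^ (x + y)                ≡⟨ cong (λ y → γ * weight S g * γ ^ (x + y)) (y′≡y s) ⟨
    γ * weight S g * γ ^ (x + y′)               ∎
    where
    open ≤-Reasoning
    x = ∣ S ∩ M ∣
    y = ∣ S ─ M ∣
    y′ = ∣ (outside ∷ S) ─ (s ∷ M) ∣
    y′≡y : ∀ s → ∣ (outside ∷ S) ─ (s ∷ M) ∣ ≡ y
    y′≡y inside  = refl
    y′≡y outside = refl
    e : ∀ γ p q r → p * q * (γ * r) ≡ γ * (p * q * r)
    e = solve-∀

-- The binomial theorem, summed over subsets instead of sizes; it evaluates the initial potential.
∑ˢ-w^∣∁∣ : ∀ n w → ∑ˢ {n} (λ A → w ^ ∣ ∁ A ∣) ≡ suc w ^ n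
∑ˢ-w^∣∁∣ zero    w = refl
∑ˢ-w^∣∁∣ (suc n) w = cong₂ _+_ (∑ˢ-w^∣∁∣ n w) (trans (∑ˢ-* {n} w _) (cong (w *_) (∑ˢ-w^∣∁∣ n w)))

∣A∣+∣∁A∣≡n : ∀ {n} (A : Subset n) → ∣ A ∣ + ∣ ∁ A ∣ ≡ n
∣A∣+∣∁A∣≡n A = trans (cong (∣ A ∣ +_) (∣∁p∣≡n∸∣p∣ A)) (m+[n∸m]≡n (∣p∣≤n A))

∣S∩M∣+∣S─M∣≡∣S∣ : ∀ {m} (S M : Subset m) → ∣ S ∩ M ∣ + ∣ S ─ M ∣ ≡ ∣ S ∣
∣S∩M∣+∣S─M∣≡∣S∣ [] [] = refl
∣S∩M∣+∣S─M∣≡∣S∣ (inside ∷ S) (inside ∷ M) = cong suc (∣S∩M∣+∣S─M∣≡∣S∣ S M)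
∣S∩M∣+∣S─M∣≡∣S∣ (inside ∷ S) (outside ∷ M) = trans (+-suc _ _) (cong suc (∣S∩M∣+∣S─M∣≡∣S∣ S M))
∣S∩M∣+∣S─M∣≡∣S∣ (outside ∷ S) (inside ∷ M) = ∣S∩M∣+∣S─M∣≡∣S∣ S M
∣S∩M∣+∣S─M∣≡∣S∣ (outside ∷ S) (outside ∷ M) = ∣S∩M∣+∣S─M∣≡∣S∣ S M

-- At the end of the stage a single summand is at most the whole potential, which has not grown
-- since the start, and the common factor γ^m cancels. The differences γ - α and β - γ become the
-- parameters μ and η of `Stage`.
shares : ∀ {m n} b (init : Subset n → ℕ) (S : Subset n → Subset m) α β γ → .{{NonZero γ}} →
  α ≤ γ → γ ≤ β → γ * β ^ b + γ ^ b * α ≤ 2 * γ ^ suc b →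
  ∀ X {Goal} → (∀ A → S A ⊆ X) →
  (∀ M → (∀ A → init A * (α ^ ∣ S A ∩ M ∣ * β ^ ∣ S A ─ M ∣) ≤ ∑ˢ init * γ ^ (∣ S A ∩ M ∣ + ∣ S A ─ M ∣)) → Goal M) →
  StageStrategy b Goal X ⊥
shares {m} {n} b init S α β γ α≤γ γ≤β fair X S⊆X goal
  with m≤n⇒∃[o]m+o≡n α≤γ | m≤n⇒∃[o]m+o≡n γ≤β
... | μ , refl | η , refl =
  steepestClaim X (∑ˢ init * γ ^ m) ∣ X ∣ X ⊥ (replicate m γ) ≤-refl (initial X) Φ-start finish
  where
  fair′ : γ * β ^ b ≤ γ ^ suc b + γ ^ b * μ
  fair′ = +-cancelʳ-≤ (γ ^ b * α) _ _ (≤-trans fair (≤-reflexive (e α μ (γ ^ b))))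
    where
    e : ∀ α μ p → 2 * ((α + μ) * p) ≡ (α + μ) * p + p * μ + p * α
    e = solve-∀
  open Stage b init S α μ η fair′ hiding (γ; β)
  open Weight γ
  Φ-start : Φ (replicate m γ) ≤ ∑ˢ init * γ ^ m
  Φ-start = ≤-reflexive (begin
    ∑ˢ (λ A → init A * weight (S A) (replicate m γ))
      ≡⟨ ∑ˢ-cong (λ A → trans (cong (init A *_) (weight-replicate (S A))) (*-comm (init A) (γ ^ m))) ⟩
    ∑ˢ (λ A → γ ^ m * init A)   ≡⟨ ∑ˢ-* {n} (γ ^ m) init ⟩
    γ ^ m * ∑ˢ init             ≡⟨ *-comm (γ ^ m) _ ⟩
    ∑ˢ init * γ ^ m             ∎)
    where open ≡-Reasoning
  finish : ∀ {U M g} → Empty U → Colouring X U M g → Φ g ≤ ∑ˢ init * γ ^ m → _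
  finish {U} {M} {g} empty col Φ≤ = goal M λ A → *-cancelʳ-≤ _ _ (γ ^ m) {{m^n≢0 γ m}} (bound A)
    where
    open ≤-Reasoning
    open Colouring col renaming (breaker to breaker′; α≤ to α≤′)
    bound : ∀ A → init A * (α ^ ∣ S A ∩ M ∣ * β ^ ∣ S A ─ M ∣) * γ ^ m
                  ≤ ∑ˢ init * γ ^ (∣ S A ∩ M ∣ + ∣ S A ─ M ∣) * γ ^ m
    bound A = begin
      init A * (α ^ x * β ^ y) * γ ^ m           ≡⟨ *-assoc (init A) _ _ ⟩
      init A * (α ^ x * β ^ y * γ ^ m)           ≤⟨ *-monoʳ-≤ (init A) (weight-final γ α β (S A) M g α≤′
                                                      λ e∈S e∉M → ≤-reflexive (sym (breaker′ (S⊆X A e∈S) (λ e∈U → empty (_ , e∈U)) e∉M))) ⟩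
      init A * (weight (S A) g * γ ^ (x + y))    ≡⟨ *-assoc (init A) _ _ ⟨
      init A * weight (S A) g * γ ^ (x + y)      ≤⟨ *-monoˡ-≤ (γ ^ (x + y)) (≤-trans (term≤∑ˢ (λ A → init A * weight (S A) g) A) Φ≤) ⟩
      ∑ˢ init * γ ^ m * γ ^ (x + y)              ≡⟨ e (∑ˢ init) (γ ^ m) (γ ^ (x + y)) ⟩
      ∑ˢ init * γ ^ (x + y) * γ ^ m              ∎
      where
      x = ∣ S A ∩ M ∣
      y = ∣ S A ─ M ∣
      e : ∀ s p q → s * p * q ≡ s * q * p
      e = solve-∀

-- The game on cuts: a single stage and the recursion over stages

module Multistage (b r : ℕ) where

  j J N P c α β γ : ℕ
  j = r * b
  J = suc j
  N = J * J
  P = suc N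
  c = r + J
  -- With θ = 1 + 1/N, Maker's, Breaker's and unclaimed elements weigh θ^-J, θ^r and 1, up to a common factor.
  α = N ^ (r + J)
  β = P ^ (r + J)
  γ = N ^ r * P ^ J

  instance
    γ≢0 : NonZero γ
    γ≢0 = m*n≢0 (N ^ r) (P ^ J) {{m^n≢0 N r}} {{m^n≢0 P J}}

  α≤γ : α ≤ γ
  α≤γ = ≤-trans (≤-reflexive (^-distribˡ-+-* N r J)) (*-monoʳ-≤ (N ^ r) (^-monoˡ-≤ J (n≤1+n N)))

  γ≤β : γ ≤ β
  γ≤β = ≤-trans (*-monoˡ-≤ (P ^ J) (^-monoˡ-≤ r (n≤1+n N))) (≤-reflexive (sym (^-distribˡ-+-* P r J)))

  -- This is `two-sided` at j = r b: b claims of Breaker multiply a weight by θ^(r b), one claim of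
  -- Maker by θ^-(r b + 1), and the rest is a common factor.
  fair : γ * β ^ b + γ ^ b * α ≤ 2 * γ ^ suc b
  fair = begin
    γ * β ^ b + γ ^ b * α
      ≡⟨ cong₂ (λ p q → γ * p + q * α) β^b γ^b ⟩
    γ * (P ^ j * P ^ (J * b)) + N ^ j * P ^ (J * b) * α
      ≡⟨ cong (λ p → γ * (P ^ j * P ^ (J * b)) + N ^ j * P ^ (J * b) * p) (^-distribˡ-+-* N r J) ⟩
    γ * (P ^ j * P ^ (J * b)) + N ^ j * P ^ (J * b) * (N ^ r * N ^ J)
      ≡⟨ e (N ^ r) (P ^ J) (P ^ j) (P ^ (J * b)) (N ^ j) (N ^ J) ⟩
    N ^ r * P ^ (J * b) * (P ^ J * P ^ j + N ^ j * N ^ J)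
      ≤⟨ *-monoʳ-≤ (N ^ r * P ^ (J * b)) (two-sided j) ⟩
    N ^ r * P ^ (J * b) * (2 * (P ^ J * N ^ j))
      ≡⟨ e′ (N ^ r) (P ^ (J * b)) (P ^ J) (N ^ j) ⟩
    2 * (γ * (N ^ j * P ^ (J * b)))
      ≡⟨ cong (λ p → 2 * (γ * p)) γ^b ⟨
    2 * γ ^ suc b ∎
    where
    open ≤-Reasoning
    β^b : β ^ b ≡ P ^ j * P ^ (J * b)
    β^b = trans (^-*-assoc P (r + J) b) (^-split P r J b)
    γ^b : γ ^ b ≡ N ^ j * P ^ (J * b)
    γ^b = trans (^-*-distribʳ (N ^ r) (P ^ J) b) (cong₂ _*_ (^-*-assoc N r b) (^-*-assoc P J b))
    e : ∀ u v w k d f → u * v * (w * k) + d * k * (u * f) ≡ u * k * (v * w + d * f)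
    e = solve-∀
    e′ : ∀ u k v d → u * k * (2 * (v * d)) ≡ 2 * (u * v * (d * k))
    e′ = solve-∀

  -- Read x and y as the edges of Maker and Breaker across the cut of a set of a vertices. The first
  -- three hypotheses give r y - J x ≥ a T, so the summand carries a factor of at least θ^(a T), and
  -- `power` says that θ^T ≥ H.
  poor⇒light : ∀ {x y a k k′ T H i Q} → c * k′ + T ≤ r * k → a * k ≤ x + y → x ≤ a * k′ →
    H * N ^ T ≤ P ^ T → i * (α ^ x * β ^ y) ≤ Q * γ ^ (x + y) → i * H ^ a ≤ Q
  poor⇒light {x} {y} {a} {k} {k′} {T} {H} {i} {Q} shrink large poor power bound
    with m≤n⇒∃[o]m+o≡n slack
    where
    open ≤-Reasoning
    slack : J * x + a * T ≤ r * y
    slack = +-cancelˡ-≤ (r * x) _ _ (begin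
      r * x + (J * x + a * T)   ≡⟨ e r J x (a * T) ⟩
      c * x + a * T             ≤⟨ +-monoˡ-≤ (a * T) (*-monoʳ-≤ c poor) ⟩
      c * (a * k′) + a * T      ≡⟨ e′ c a k′ T ⟩
      a * (c * k′ + T)          ≤⟨ *-monoʳ-≤ a shrink ⟩
      a * (r * k)               ≡⟨ e″ a r k ⟩
      r * (a * k)               ≤⟨ *-monoʳ-≤ r large ⟩
      r * (x + y)               ≡⟨ *-distribˡ-+ r x y ⟩
      r * x + r * y             ∎)
      where
      e : ∀ r J x t → r * x + (J * x + t) ≡ (r + J) * x + t
      e = solve-∀
      e′ : ∀ c a k T → c * (a * k) + a * T ≡ a * (c * k + T)
      e′ = solve-∀
      e″ : ∀ a r k → a * (r * k) ≡ r * (a * k)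
      e″ = solve-∀
  ... | z , ry = *-cancelʳ-≤ _ _ C {{C≢0}} (begin
    i * H ^ a * C
      ≡⟨ e₁ i (H ^ a) ((N ^ T) ^ a) (N ^ z) K ⟩
    i * ((H ^ a * (N ^ T) ^ a) * N ^ z) * K
      ≡⟨ cong (λ p → i * (p * N ^ z) * K) (^-*-distribʳ H (N ^ T) a) ⟨
    i * ((H * N ^ T) ^ a * N ^ z) * K
      ≤⟨ *-monoˡ-≤ K (*-monoʳ-≤ i (*-mono-≤ (^-monoˡ-≤ a power) (^-monoˡ-≤ z (n≤1+n N)))) ⟩
    i * ((P ^ T) ^ a * P ^ z) * K
      ≡⟨ e₂ i ((P ^ T) ^ a) (P ^ z) (N ^ (r * x)) (N ^ (J * x)) (P ^ (J * x)) (P ^ (J * y)) ⟩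
    i * ((N ^ (r * x) * N ^ (J * x)) * ((P ^ (J * x) * (P ^ T) ^ a * P ^ z) * P ^ (J * y)))
      ≡⟨ cong₂ (λ p q → i * (p * q)) α^x (cong (_* P ^ (J * y)) (ry-power P)) ⟨
    i * (α ^ x * (P ^ (r * y) * P ^ (J * y)))
      ≡⟨ cong (λ p → i * (α ^ x * p)) β^y ⟨
    i * (α ^ x * β ^ y)
      ≤⟨ bound ⟩
    Q * γ ^ (x + y)
      ≡⟨ cong (Q *_) γ^x+y ⟩
    Q * ((N ^ (r * x) * N ^ (r * y)) * (P ^ (J * x) * P ^ (J * y)))
      ≡⟨ cong (λ p → Q * ((N ^ (r * x) * p) * (P ^ (J * x) * P ^ (J * y)))) (ry-power N) ⟩
    Q * ((N ^ (r * x) * (N ^ (J * x) * (N ^ T) ^ a * N ^ z)) * (P ^ (J * x) * P ^ (J * y)))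
      ≡⟨ e₃ Q (N ^ (r * x)) (N ^ (J * x)) ((N ^ T) ^ a) (N ^ z) (P ^ (J * x)) (P ^ (J * y)) ⟩
    Q * C ∎)
    where
    open ≤-Reasoning
    K = N ^ (r * x) * N ^ (J * x) * (P ^ (J * x) * P ^ (J * y))
    C = (N ^ T) ^ a * N ^ z * K
    C≢0 : NonZero C
    C≢0 = m*n≢0 ((N ^ T) ^ a * N ^ z) K
      {{m*n≢0 ((N ^ T) ^ a) (N ^ z) {{m^n≢0 (N ^ T) a {{m^n≢0 N T}}}} {{m^n≢0 N z}}}}
      {{m*n≢0 _ _ {{m*n≢0 _ _ {{m^n≢0 N (r * x)}} {{m^n≢0 N (J * x)}}}}
                  {{m*n≢0 _ _ {{m^n≢0 P (J * x)}} {{m^n≢0 P (J * y)}}}}}}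
    ry-power : ∀ m → m ^ (r * y) ≡ m ^ (J * x) * (m ^ T) ^ a * m ^ z
    ry-power m = begin-equality
      m ^ (r * y)                              ≡⟨ cong (m ^_) ry ⟨
      m ^ (J * x + a * T + z)                  ≡⟨ ^-distribˡ-+-* m (J * x + a * T) z ⟩
      m ^ (J * x + a * T) * m ^ z              ≡⟨ cong (_* m ^ z) (^-distribˡ-+-* m (J * x) (a * T)) ⟩
      m ^ (J * x) * m ^ (a * T) * m ^ z        ≡⟨ cong (λ p → m ^ (J * x) * p * m ^ z)
                                                    (trans (cong (m ^_) (*-comm a T)) (sym (^-*-assoc m T a))) ⟩
      m ^ (J * x) * (m ^ T) ^ a * m ^ z        ∎
    α^x : α ^ x ≡ N ^ (r * x) * N ^ (J * x)
    α^x = trans (^-*-assoc N (r + J) x) (^-split N r J x)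
    β^y : β ^ y ≡ P ^ (r * y) * P ^ (J * y)
    β^y = trans (^-*-assoc P (r + J) y) (^-split P r J y)
    ^-split′ : ∀ m s → (m ^ s) ^ (x + y) ≡ m ^ (s * x) * m ^ (s * y)
    ^-split′ m s = trans (^-*-assoc m s (x + y)) (trans (cong (m ^_) (*-distribˡ-+ s x y)) (^-distribˡ-+-* m (s * x) (s * y)))
    γ^x+y : γ ^ (x + y) ≡ (N ^ (r * x) * N ^ (r * y)) * (P ^ (J * x) * P ^ (J * y))
    γ^x+y = trans (^-*-distribʳ (N ^ r) (P ^ J) (x + y)) (cong₂ _*_ (^-split′ N r) (^-split′ P J))
    e₁ : ∀ i h t z k → i * h * (t * z * k) ≡ i * ((h * t) * z) * k
    e₁ = solve-∀
    e₂ : ∀ i t z u v w s → i * (t * z) * (u * v * (w * s)) ≡ i * ((u * v) * ((w * t * z) * s))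
    e₂ = solve-∀
    e₃ : ∀ Q u v t z w s → Q * ((u * (v * t * z)) * (w * s)) ≡ Q * (t * z * (u * v * (w * s)))
    e₃ = solve-∀

-- In each stage T is lost to the potential and up to c to integer division; the shift of k by T + r
-- must absorb both. The terms in T are compared through r + 1 ≤ c, the others through r² ≤ c (r -
-- 1), where 2 ≤ r enters.
linearOverhead : ∀ r c T → 2 ≤ r → suc (r + r) ≤ c → T + r * T + r * r + c ≤ c * T + c * r
linearOverhead (suc (suc r)) c T (s≤s (s≤s z≤n)) 2r<c = begin
  T + R * T + R * R + c                   ≡⟨ +-assoc (T + R * T) (R * R) c ⟩
  suc R * T + (R * R + c)                 ≤⟨ +-mono-≤ (*-monoˡ-≤ T (≤-trans (s≤s (m≤m+n R R)) 2r<c)) (+-monoˡ-≤ c (begin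
    R * R                                     ≤⟨ ≤-by _ (e r) ⟩
    suc (R + R) * suc r                       ≤⟨ *-monoˡ-≤ (suc r) 2r<c ⟩
    c * suc r                                 ∎)) ⟩
  c * T + (c * suc r + c)                 ≡⟨ cong (c * T +_) (trans (+-comm (c * suc r) c) (sym (*-suc c (suc r)))) ⟩
  c * T + c * R                           ∎
  where
  open ≤-Reasoning
  R = suc (suc r)
  e : ∀ r → suc (suc r) * suc (suc r) + (1 + 3 * r + r * r) ≡ suc (suc (suc r) + suc (suc r)) * suc r
  e = solve-∀

module Connectivity (n b r T : ℕ) (1≤n : 1 ≤ n)
  (power : 3 * (2 * n) * Multistage.N b r ^ T ≤ Multistage.P b r ^ T) where

  open Multistage b r
  open MonotoneGame b (Connected n)

  Rich : ℕ → EdgeSet n → Set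
  Rich k X = ∀ A → 1 ≤ ∣ A ∣ → 2 * ∣ A ∣ ≤ n → ∣ A ∣ * k ≤ ∣ cut (edges n) A ∩ X ∣

  w : ℕ
  w = 2 * n

  instance
    w≢0 : NonZero w
    w≢0 = >-nonZero (≤-trans 1≤n (m≤m+n n (n + 0)))

  stage : ∀ {k k′ X} → c * k′ + T ≤ r * k → Rich k X → StageStrategy b (Rich k′) X ⊥
  stage {k} {k′} {X} shrink rich =
    shares b (λ A → w ^ ∣ ∁ A ∣) (λ A → cut (edges n) A ∩ X) α β γ α≤γ γ≤β fair X
      (λ A → p∩q⊆q (cut (edges n) A) X) finish
    where
    finish : ∀ M → _ → Rich k′ M
    finish M light A 1≤a 2a≤n = ≮⇒≥ λ poor → <⇒≱ heavy
      (poor⇒light {a = ∣ A ∣} {H = 3 * w} {i = w ^ ∣ ∁ A ∣} shrink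
        (≤-trans (rich A 1≤a 2a≤n) (≤-reflexive (sym (∣S∩M∣+∣S─M∣≡∣S∣ (cut (edges n) A ∩ X) M))))
        (≤-trans (p⊆q⇒∣p∣≤∣q∣ {p = (cut (edges n) A ∩ X) ∩ M} {q = cut (edges n) A ∩ M} forget) (<⇒≤ poor))
        power (light A))
      where
      open ≤-Reasoning
      forget : (cut (edges n) A ∩ X) ∩ M ⊆ cut (edges n) A ∩ M
      forget e∈ = let e∈cut∩X , e∈M = x∈p∩q⁻ (cut (edges n) A ∩ X) M e∈ in
        x∈p∩q⁺ (p∩q⊆p (cut (edges n) A) X e∈cut∩X , e∈M)
      -- Since (2n)^(n - |A|) (6n)^|A| = 3^|A| (2n)^n, the 3 in 6n beats the factor 2 by which (2n +
      -- 1)^n may exceed (2n)^n.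
      heavy : ∑ˢ {n} (λ A → w ^ ∣ ∁ A ∣) < w ^ ∣ ∁ A ∣ * (3 * w) ^ ∣ A ∣
      heavy = begin-strict
        ∑ˢ {n} (λ A → w ^ ∣ ∁ A ∣)                ≡⟨ ∑ˢ-w^∣∁∣ n w ⟩
        suc w ^ n                                 ≤⟨ [1+w]^i≤2w^i n w 1≤n ≤-refl ⟩
        2 * w ^ n                                 <⟨ *-monoˡ-< (w ^ n) {{m^n≢0 w n}} {2} {3} (n<1+n 2) ⟩
        3 * w ^ n                                 ≤⟨ *-monoˡ-≤ (w ^ n) (^-monoʳ-≤ 3 1≤a) ⟩
        3 ^ ∣ A ∣ * w ^ n                         ≡⟨ cong (λ m → 3 ^ ∣ A ∣ * w ^ m) (∣A∣+∣∁A∣≡n A) ⟨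
        3 ^ ∣ A ∣ * w ^ (∣ A ∣ + ∣ ∁ A ∣)         ≡⟨ cong (3 ^ ∣ A ∣ *_) (^-distribˡ-+-* w ∣ A ∣ ∣ ∁ A ∣) ⟩
        3 ^ ∣ A ∣ * (w ^ ∣ A ∣ * w ^ ∣ ∁ A ∣)     ≡⟨ e (3 ^ ∣ A ∣) (w ^ ∣ A ∣) (w ^ ∣ ∁ A ∣) ⟩
        w ^ ∣ ∁ A ∣ * (3 ^ ∣ A ∣ * w ^ ∣ A ∣)     ≡⟨ cong (w ^ ∣ ∁ A ∣ *_) (^-*-distribʳ 3 w ∣ A ∣) ⟨
        w ^ ∣ ∁ A ∣ * (3 * w) ^ ∣ A ∣             ∎
        where
        e : ∀ p q r → p * (q * r) ≡ r * (p * q)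
        e = solve-∀

  rich⇒connected : ∀ {k X} → 1 ≤ k → Rich k X → Connected n X
  rich⇒connected {k} {X} 1≤k rich = leaves⇒connected λ A nonempty nonempty∁ →
    cut-nonempty⇒leaves A (crossed A nonempty nonempty∁)
    where
    open ≤-Reasoning
    smallCrossed : ∀ A → 1 ≤ ∣ A ∣ → 2 * ∣ A ∣ ≤ n → Nonempty (cut (edges n) A ∩ X)
    smallCrossed A 1≤a 2a≤n = 1≤∣p∣⇒nonempty (cut (edges n) A ∩ X)
      (≤-trans (*-mono-≤ 1≤a 1≤k) (rich A 1≤a 2a≤n))
    crossed : ∀ A → Nonempty A → Nonempty (∁ A) → Nonempty (cut (edges n) A ∩ X)
    crossed A nonempty nonempty∁ with ≤-total ∣ A ∣ ∣ ∁ A ∣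
    ... | inj₁ a≤ā = smallCrossed A (nonempty⇒1≤∣p∣ nonempty) (begin
      ∣ A ∣ + (∣ A ∣ + 0)     ≤⟨ +-monoʳ-≤ ∣ A ∣ (≤-trans (≤-reflexive (+-identityʳ ∣ A ∣)) a≤ā) ⟩
      ∣ A ∣ + ∣ ∁ A ∣         ≡⟨ ∣A∣+∣∁A∣≡n A ⟩
      n                       ∎)
    ... | inj₂ ā≤a = subst (λ S → Nonempty (S ∩ X)) (cut-∁ (edges n) A) (smallCrossed (∁ A) (nonempty⇒1≤∣p∣ nonempty∁) (begin
      ∣ ∁ A ∣ + (∣ ∁ A ∣ + 0) ≤⟨ +-mono-≤ ā≤a (≤-reflexive (+-identityʳ ∣ ∁ A ∣)) ⟩
      ∣ A ∣ + ∣ ∁ A ∣         ≡⟨ ∣A∣+∣∁A∣≡n A ⟩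
      n                       ∎))

  ⊤-rich : ∀ k → 2 * k ≤ n → Rich k ⊤
  ⊤-rich k 2k≤n A 1≤a 2a≤n = begin
    ∣ A ∣ * k                       ≤⟨ *-monoʳ-≤ ∣ A ∣ k≤ā ⟩
    ∣ A ∣ * ∣ ∁ A ∣                 ≤⟨ ∣A∣*∣∁A∣≤∣cut∣ n A ⟩
    ∣ cut (edges n) A ∣             ≡⟨ cong ∣_∣ (∩-identityʳ (cut (edges n) A)) ⟨
    ∣ cut (edges n) A ∩ ⊤ ∣         ∎
    where
    open ≤-Reasoning
    k≤ā : k ≤ ∣ ∁ A ∣
    k≤ā = *-cancelˡ-≤ 2 (+-cancelˡ-≤ (2 * ∣ A ∣) _ _ (begin
      2 * ∣ A ∣ + 2 * k         ≤⟨ +-mono-≤ 2a≤n 2k≤n ⟩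
      n + n                     ≡⟨ cong (n +_) (+-identityʳ n) ⟨
      2 * n                     ≡⟨ cong (2 *_) (∣A∣+∣∁A∣≡n A) ⟨
      2 * (∣ A ∣ + ∣ ∁ A ∣)     ≡⟨ *-distribˡ-+ 2 ∣ A ∣ ∣ ∁ A ∣ ⟩
      2 * ∣ A ∣ + 2 * ∣ ∁ A ∣   ∎))

  module _ (1≤b : 1 ≤ b) (2≤r : 2 ≤ r) where

    overhead : T + r * T + r * r + c ≤ c * T + c * r
    overhead = linearOverhead r c T 2≤r (begin
      suc (r + r)         ≡⟨ +-suc r r ⟨
      r + suc r           ≤⟨ +-monoʳ-≤ r (s≤s (m≤m*n r b {{>-nonZero 1≤b}})) ⟩
      r + suc (r * b)     ∎)
      where open ≤-Reasoning

    -- Shifting k by T + r turns the affine recursion c k′ + T ≤ r k into a geometric one.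
    rich⇒wins : ∀ s k X → c ^ s * (1 + T + r) ≤ r ^ s * (k + T + r) → Rich k X → Wins s X
    rich⇒wins zero k X enough rich = rich⇒connected {k} (+-cancelʳ-≤ (T + r) 1 k (begin
      1 + (T + r)     ≡⟨ +-assoc 1 T r ⟨
      1 + T + r       ≡⟨ *-identityˡ (1 + T + r) ⟨
      1 * (1 + T + r) ≤⟨ enough ⟩
      1 * (k + T + r) ≡⟨ *-identityˡ (k + T + r) ⟩
      k + T + r       ≡⟨ +-assoc k T r ⟩
      k + (T + r)     ∎)) rich
      where open ≤-Reasoning
    rich⇒wins (suc s) k X enough rich with T ≤? r * k
    -- A board too poor for another stage contradicts `enough`: r (k + T + r) would stay below c (1
    -- + T + r).
    ... | no T≰rk = contradiction enough (<⇒≱ (begin-strict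
      r * r ^ s * (k + T + r)          ≡⟨ e r (r ^ s) k T ⟩
      r ^ s * (r * k + (r * T + r * r)) ≤⟨ *-mono-≤ (^-monoˡ-≤ s (m≤m+n r J)) (+-monoˡ-≤ (r * T + r * r) (<⇒≤ (≰⇒> T≰rk))) ⟩
      c ^ s * (T + (r * T + r * r))    <⟨ *-monoʳ-< (c ^ s) {{m^n≢0 c s {{c≢0}}}} excess ⟩
      c ^ s * (c * (1 + T + r))        ≡⟨ e′ (c ^ s) c (1 + T + r) ⟩
      c * c ^ s * (1 + T + r)          ∎))
      where
      open ≤-Reasoning
      c≢0 : NonZero c
      c≢0 = >-nonZero (≤-trans (s≤s z≤n) (m≤n+m J r))
      e : ∀ r p k T → r * p * (k + T + r) ≡ p * (r * k + (r * T + r * r))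
      e = solve-∀
      e′ : ∀ p c q → p * (c * q) ≡ c * p * q
      e′ = solve-∀
      e″ : ∀ T a b c → T + (a + b) + c ≡ T + a + b + c
      e″ = solve-∀
      e‴ : ∀ c T r → c * (1 + T + r) ≡ c * T + c * r + c
      e‴ = solve-∀
      excess : T + (r * T + r * r) < c * (1 + T + r)
      excess = begin-strict
        T + (r * T + r * r)       ≤⟨ m≤m+n _ c ⟩
        T + (r * T + r * r) + c   ≡⟨ e″ T (r * T) (r * r) c ⟩
        T + r * T + r * r + c     ≤⟨ overhead ⟩
        c * T + c * r             <⟨ m<m+n _ (≤-trans (s≤s z≤n) (m≤n+m J r)) ⟩
        c * T + c * r + c         ≡⟨ e‴ c T r ⟨
        c * (1 + T + r)           ∎
    ... | yes T≤rk with m≤n⇒∃[o]m+o≡n T≤rk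
    ...   | o , T+o≡rk = mapGoal (λ {X′} _ → rich⇒wins s k′ X′ enough′) (stage {k} {k′} shrink rich)
      where
      open ≤-Reasoning
      instance
        c≢0 : NonZero c
        c≢0 = >-nonZero (≤-trans (s≤s z≤n) (m≤n+m J r))
      -- The largest admissible value; the remainder of the division costs less than c, which
      -- `overhead` absorbs.
      k′ = o / c
      o≡ : o ≡ o % c + k′ * c
      o≡ = m≡m%n+[m/n]*n o c
      shrink : c * k′ + T ≤ r * k
      shrink = begin
        c * k′ + T   ≤⟨ +-monoˡ-≤ T (≤-trans (≤-reflexive (*-comm c k′)) (≤-trans (m≤n+m (k′ * c) (o % c)) (≤-reflexive (sym o≡)))) ⟩
        o + T        ≡⟨ +-comm o T ⟩
        T + o        ≡⟨ T+o≡rk ⟩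
        r * k        ∎
      step : r * (k + T + r) ≤ c * (k′ + T + r)
      step = begin
        r * (k + T + r)                         ≡⟨ e₁ r k T ⟩
        r * k + (r * T + r * r)                 ≡⟨ cong (_+ (r * T + r * r)) T+o≡rk ⟨
        T + o + (r * T + r * r)                 ≤⟨ +-monoˡ-≤ _ (+-monoʳ-≤ T (≤-trans (≤-reflexive o≡) (+-monoˡ-≤ (k′ * c) (<⇒≤ (m%n<n o c))))) ⟩
        T + (c + k′ * c) + (r * T + r * r)      ≡⟨ e₂ T c k′ (r * T) (r * r) ⟩
        T + r * T + r * r + c + c * k′          ≤⟨ +-monoˡ-≤ (c * k′) overhead ⟩
        c * T + c * r + c * k′                  ≡⟨ e₃ c T r k′ ⟩
        c * (k′ + T + r)                        ∎
        where
        e₁ : ∀ r k T → r * (k + T + r) ≡ r * k + (r * T + r * r)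
        e₁ = solve-∀
        e₂ : ∀ T c k x y → T + (c + k * c) + (x + y) ≡ T + x + y + c + c * k
        e₂ = solve-∀
        e₃ : ∀ c T r k → c * T + c * r + c * k ≡ c * (k + T + r)
        e₃ = solve-∀
      enough′ : c ^ s * (1 + T + r) ≤ r ^ s * (k′ + T + r)
      enough′ = *-cancelˡ-≤ c (begin
        c * (c ^ s * (1 + T + r))      ≡⟨ *-assoc c (c ^ s) _ ⟨
        c * c ^ s * (1 + T + r)        ≤⟨ enough ⟩
        r * r ^ s * (k + T + r)        ≡⟨ e r (r ^ s) (k + T + r) ⟩
        r ^ s * (r * (k + T + r))      ≤⟨ *-monoʳ-≤ (r ^ s) step ⟩
        r ^ s * (c * (k′ + T + r))     ≡⟨ e′ (r ^ s) c (k′ + T + r) ⟩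
        c * (r ^ s * (k′ + T + r))     ∎)
        where
        e : ∀ r p q → r * p * q ≡ p * (r * q)
        e = solve-∀
        e′ : ∀ p c q → p * (c * q) ≡ c * (p * q)
        e′ = solve-∀

-- The threshold and its growth

n<2^n : ∀ n → n < 2 ^ n
n<2^n zero    = s≤s z≤n
n<2^n (suc n) = +-mono-≤ (≤-trans (s≤s z≤n) (n<2^n n)) (≤-trans (n<2^n n) (≤-reflexive (sym (+-identityʳ _))))

^-cancelˡ-≤ : ∀ e {m n} .{{_ : NonZero e}} → m ^ e ≤ n ^ e → m ≤ n
^-cancelˡ-≤ e m^e≤n^e = ≮⇒≥ λ n<m → <⇒≱ (^-monoˡ-< e n<m) m^e≤n^e

integerRoot : ∀ D n .{{_ : NonZero D}} → 1 ≤ n → ∃[ y ] 1 ≤ y × y ^ D ≤ n × n < suc y ^ D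
integerRoot D (suc zero) _ = 1 , ≤-refl , ≤-reflexive (^-zeroˡ D) , ≤-trans (≤-trans (n<2^n 1) (≤-reflexive (sym (^-identityʳ 2)))) (^-monoʳ-≤ 2 (>-nonZero⁻¹ D))
integerRoot D (suc (suc n)) _ with integerRoot D (suc n) (s≤s z≤n)
... | y , 1≤y , y^D≤ , <[1+y]^D with suc (suc n) <? suc y ^ D
...   | yes small = y , 1≤y , m≤n⇒m≤1+n y^D≤ , small
...   | no  large = suc y , s≤s z≤n , ≮⇒≥ large , ≤-<-trans <[1+y]^D (^-monoˡ-< D (n<1+n (suc y)))

ceilingLog : ∀ B v → 2 ≤ B → 1 ≤ v → ∃[ s ] v ≤ B ^ s × B ^ s ≤ B * v
ceilingLog B (suc zero) 2≤B _ = 0 , ≤-refl , ≤-trans (≤-trans (s≤s z≤n) 2≤B) (≤-reflexive (sym (*-identityʳ B)))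
ceilingLog B (suc (suc v)) 2≤B _ with ceilingLog B (suc v) 2≤B (s≤s z≤n)
... | s , v≤B^s , B^s≤Bv with suc (suc v) ≤? B ^ s
...   | yes reached = s , reached , ≤-trans B^s≤Bv (*-monoʳ-≤ B (n≤1+n (suc v)))
...   | no  below = suc s , (begin
    suc (suc v)          ≤⟨ s≤s (m≤n+m (suc v) v) ⟩
    suc v + suc v        ≤⟨ +-mono-≤ v≤B^s (≤-trans v≤B^s (≤-reflexive (sym (+-identityʳ (B ^ s))))) ⟩
    2 * B ^ s            ≤⟨ *-monoˡ-≤ (B ^ s) 2≤B ⟩
    B * B ^ s            ∎) , *-monoʳ-≤ B (<⇒≤ (≰⇒> below))
  where open ≤-Reasoning

module _ (n b : ℕ) where
  open MonotoneGame b (Connected n)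

  wins⇒ensures : ∀ s → Wins s ⊤ → MakerEnsures (𝓒 n) b s
  wins⇒ensures s = wins⇒survives spanningTree s ⊤ (IsSpanningTree n) λ _ tree _ → tree

  ensures⇒wins : ∀ s → MakerEnsures (𝓒 n) b s → Wins s ⊤
  ensures⇒wins s = survives⇒wins (λ (connected , _) F⊆X → connected-mono F⊆X connected)
    s ⊤ (IsSpanningTree n) λ _ tree → tree , ⊆-max _

  -- Breaker's greedy play leaves a connected Y with (b + 1)^s (|Y| - 1) < n². From n ≥ 3 and n ≤ 2
  -- |Y| follows |Y| ≥ 2, hence |Y| - 1 ≥ n / 6.
  ensures⇒small : 3 ≤ n → ∀ s → MakerEnsures (𝓒 n) b s → suc b ^ s ≤ 6 * n
  ensures⇒small 3≤n s ensures with wins⇒small s ⊤ (ensures⇒wins s ensures)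
  ... | Y , connected , bound = *-cancelʳ-≤ _ _ n {{>-nonZero (≤-trans (s≤s z≤n) 3≤n)}} (begin
    suc b ^ s * n                   ≤⟨ *-monoʳ-≤ (suc b ^ s) (many ∣ Y ∣ (connected⇒n≤2∣X∣ (≤-trans (s≤s (s≤s z≤n)) 3≤n) connected)) ⟩
    suc b ^ s * (6 * pred ∣ Y ∣)    ≡⟨ e (suc b ^ s) (pred ∣ Y ∣) ⟩
    6 * (suc b ^ s * pred ∣ Y ∣)    ≤⟨ *-monoʳ-≤ 6 bound ⟩
    6 * pred ∣ ⊤ {length (edges n)} ∣ ≤⟨ *-monoʳ-≤ 6 (≤-trans pred[n]≤n (≤-trans (≤-reflexive (∣⊤∣≡n (length (edges n)))) (∣edges∣≤ n))) ⟩
    6 * (n * n)                     ≡⟨ *-assoc 6 n n ⟨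
    6 * n * n                       ∎)
    where
    open ≤-Reasoning
    e : ∀ p y → p * (6 * y) ≡ 6 * (p * y)
    e = solve-∀
    many : ∀ y → n ≤ 2 * y → n ≤ 6 * pred y
    many zero          n≤ = contradiction (≤-trans 3≤n n≤) λ ()
    many (suc zero)    n≤ = contradiction (≤-trans 3≤n n≤) λ { (s≤s (s≤s ())) }
    many (suc (suc y)) n≤ = ≤-trans n≤ (≤-by (2 + 4 * y) (e′ y))
      where
      e′ : ∀ y → 2 * suc (suc y) + (2 + 4 * y) ≡ 6 * suc y
      e′ = solve-∀

  threshold : 1 ≤ b → 3 ≤ n → ∃[ t ] IsThreshold (𝓒 n) b t
  threshold 1≤b 3≤n = maximum (MakerEnsures (𝓒 n) b)
    (λ s → map′ (wins⇒ensures s) (ensures⇒wins s) (wins? (connected? n) s ⊤))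
    (wins⇒ensures 0 (connected-⊤ n)) (6 * n) λ s ensures → begin
      s             ≤⟨ <⇒≤ (n<2^n s) ⟩
      2 ^ s         ≤⟨ ^-monoˡ-≤ s (s≤s 1≤b) ⟩
      suc b ^ s     ≤⟨ ensures⇒small 3≤n s ensures ⟩
      6 * n         ∎
    where
    open ≤-Reasoning

-- y stands in for log n: it is the integer D-th root of n, so n ≤ 2^(D y) while y ≤ n^(1/D).
module Parameters (n b y q′ : ℕ) (1≤b : 1 ≤ b) where

  q R D β : ℕ
  q = suc q′
  R = 2 * q
  D = 2 * R
  β = suc b

  -- As θ^N ≥ 2, this makes θ^T at least 2^(D y + 3), hence at least 8 n once n < (y + 1)^D; the
  -- potential asks for 6 n.
  T : ℕ
  T = Multistage.N b R * (D * y + 3)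

  -- Depends on q alone: the overhead 1 + T + R is split into C and b² y, using N = (R b + 1)² ≤ (2
  -- R b)².
  C : ℕ
  C = 1 + R + 4 * R * R * (D + 3)

  power : n < suc y ^ D → let open Multistage b R in 3 * (2 * n) * N ^ T ≤ P ^ T
  power n<[1+y]^D = begin
    3 * (2 * n) * N ^ T            ≤⟨ *-monoˡ-≤ (N ^ T) 6n≤2^x ⟩
    2 ^ x * N ^ T                  ≡⟨ cong (2 ^ x *_) (^-*-assoc N N x) ⟨
    2 ^ x * (N ^ N) ^ x            ≡⟨ ^-*-distribʳ 2 (N ^ N) x ⟨
    (2 * N ^ N) ^ x                ≤⟨ ^-monoˡ-≤ x (2w^w≤[1+w]^w N) ⟩
    (P ^ N) ^ x                    ≡⟨ ^-*-assoc P N x ⟩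
    P ^ T                          ∎
    where
    open ≤-Reasoning
    open Multistage b R
    x = D * y + 3
    n≤2^Dy : n ≤ 2 ^ (D * y)
    n≤2^Dy = begin
      n               ≤⟨ <⇒≤ n<[1+y]^D ⟩
      suc y ^ D       ≤⟨ ^-monoˡ-≤ D (n<2^n y) ⟩
      (2 ^ y) ^ D     ≡⟨ ^-*-assoc 2 y D ⟩
      2 ^ (y * D)     ≡⟨ cong (2 ^_) (*-comm y D) ⟩
      2 ^ (D * y)     ∎
    6n≤2^x : 3 * (2 * n) ≤ 2 ^ x
    6n≤2^x = begin
      3 * (2 * n)         ≤⟨ ≤-by (2 * n) (e n) ⟩
      n * 8               ≤⟨ *-monoˡ-≤ 8 n≤2^Dy ⟩
      2 ^ (D * y) * 2 ^ 3 ≡⟨ ^-distribˡ-+-* 2 (D * y) 3 ⟨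
      2 ^ x               ∎
      where
      e : ∀ n → 3 * (2 * n) + 2 * n ≡ n * 8
      e = solve-∀

  overhead≤ : 1 ≤ y → 1 + T + R ≤ C * (b * b * y)
  overhead≤ 1≤y = begin
    1 + T + R                              ≡⟨ e₁ T R ⟩
    (1 + R) * 1 + T                        ≤⟨ +-mono-≤ (*-monoʳ-≤ (1 + R) 1≤b²y) T≤ ⟩
    (1 + R) * (b * b * y) + 4 * R * R * (D + 3) * (b * b * y) ≡⟨ *-distribʳ-+ (b * b * y) (1 + R) _ ⟨
    C * (b * b * y)                        ∎
    where
    open ≤-Reasoning
    e₁ : ∀ T R → 1 + T + R ≡ (1 + R) * 1 + T
    e₁ = solve-∀
    1≤b²y : 1 ≤ b * b * y
    1≤b²y = *-mono-≤ (*-mono-≤ 1≤b 1≤b) 1≤y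
    J≤ : suc (R * b) ≤ 2 * (R * b)
    J≤ = +-mono-≤ {1} {R * b} (*-mono-≤ {1} {R} (s≤s z≤n) 1≤b) (≤-reflexive (sym (+-identityʳ (R * b))))
    e₂ : ∀ R b D y → (2 * (R * b)) * (2 * (R * b)) * (D * y + 3 * y) ≡ 4 * R * R * (D + 3) * (b * b * y)
    e₂ = solve-∀
    T≤ : T ≤ 4 * R * R * (D + 3) * (b * b * y)
    T≤ = begin
      suc (R * b) * suc (R * b) * (D * y + 3)          ≤⟨ *-mono-≤ (*-mono-≤ J≤ J≤) (+-monoʳ-≤ (D * y) (*-monoʳ-≤ 3 1≤y)) ⟩
      (2 * (R * b)) * (2 * (R * b)) * (D * y + 3 * y)  ≡⟨ e₂ R b D y ⟩
      4 * R * R * (D + 3) * (b * b * y)                ∎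

-- How many stages Maker survives

^-swap : ∀ m i j → (m ^ i) ^ j ≡ (m ^ j) ^ i
^-swap m i j = trans (^-*-assoc m i j) (trans (cong (m ^_) (*-comm i j)) (sym (^-*-assoc m j i)))

half : ∀ n → 2 ≤ n → ∃[ k ] 2 * k ≤ n × n ≤ 3 * k
half n 2≤n = n / 2 , ≤-trans (≤-reflexive (*-comm 2 (n / 2))) (m/n*n≤m n 2) , (begin
  n                     ≡⟨ m≡m%n+[m/n]*n n 2 ⟩
  n % 2 + n / 2 * 2     ≤⟨ +-monoˡ-≤ (n / 2 * 2) (≤-trans (≤-pred (m%n<n n 2)) (m≥n⇒m/n>0 2≤n)) ⟩
  n / 2 + n / 2 * 2     ≡⟨ e (n / 2) ⟩
  3 * (n / 2)           ∎)
  where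
  open ≤-Reasoning
  e : ∀ k → k + k * 2 ≡ 3 * k
  e = solve-∀

module _ (n b y q′ : ℕ) (1≤b : 1 ≤ b) (2≤n : 2 ≤ n) where

  open Parameters n b y q′ 1≤b
  open MonotoneGame b (Connected n)
  private
    W = 1 + T + R

  -- Here β² (3 W) ≤ z^4 y with z = 12 C b. The 2R-th powers of z^4 and of y are each at most n,
  -- which explains D = 2 R and the exponent 8 R.
  smallOverhead : 1 ≤ y → y ^ D ≤ n → (12 * C * b) ^ (8 * R) ≤ n → (β * β * (3 * W)) ^ R ≤ n
  smallOverhead 1≤y y^D≤n z^8R≤n = ^-cancelˡ-≤ 2 (begin
    ((β * β * (3 * W)) ^ R) ^ 2     ≤⟨ ^-monoˡ-≤ 2 (^-monoˡ-≤ R W≤) ⟩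
    ((z ^ 4 * y) ^ R) ^ 2           ≡⟨ ^-swap (z ^ 4 * y) R 2 ⟩
    ((z ^ 4 * y) ^ 2) ^ R           ≡⟨ cong (_^ R) (^-*-distribʳ (z ^ 4) y 2) ⟩
    ((z ^ 4) ^ 2 * y ^ 2) ^ R       ≡⟨ ^-*-distribʳ ((z ^ 4) ^ 2) (y ^ 2) R ⟩
    ((z ^ 4) ^ 2) ^ R * (y ^ 2) ^ R ≡⟨ cong₂ _*_ (trans (cong (_^ R) (^-*-assoc z 4 2)) (^-*-assoc z 8 R)) (^-*-assoc y 2 R) ⟩
    z ^ (8 * R) * y ^ D             ≤⟨ *-mono-≤ z^8R≤n y^D≤n ⟩
    n * n                           ≡⟨ cong (n *_) (*-identityʳ n) ⟨
    n ^ 2                           ∎)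
    where
    open ≤-Reasoning
    z = 12 * C * b
    b≤z : b ≤ z
    b≤z = m≤n*m b (12 * C)
    β≤2b : β ≤ 2 * b
    β≤2b = +-mono-≤ 1≤b (≤-reflexive (sym (+-identityʳ b)))
    e₁ : ∀ b C y → (2 * b) * (2 * b) * (3 * (C * (b * b * y))) ≡ 12 * C * b * (b * (b * (b * 1))) * y
    e₁ = solve-∀
    W≤ : β * β * (3 * W) ≤ z ^ 4 * y
    W≤ = begin
      β * β * (3 * W)                               ≤⟨ *-mono-≤ (*-mono-≤ β≤2b β≤2b) (*-monoʳ-≤ 3 (overhead≤ 1≤y)) ⟩
      (2 * b) * (2 * b) * (3 * (C * (b * b * y)))   ≡⟨ e₁ b C y ⟩
      z * b ^ 3 * y                                 ≤⟨ *-monoˡ-≤ y (*-monoʳ-≤ z (^-monoˡ-≤ 3 b≤z)) ⟩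
      z ^ 4 * y                                     ∎

  -- The stages are counted so that β^s lies between n^(1 - 1/q) and β times that. Since R = 2q,
  -- (β^s)^R is then n^(R - 2) up to powers of β, which leaves two factors n below n^R. One pays for
  -- the factors 1 + 1/(R β) of all stages; the other, through the last hypothesis, pays for W, for
  -- the powers of β and for the 3 lost in halving n.
  manyStages : 1 ≤ y → n < suc y ^ D → (β * β * (3 * W)) ^ R ≤ n →
    ∃[ s ] n ^ q′ ≤ (β ^ q) ^ s × Wins s ⊤
  manyStages 1≤y n<[1+y]^D small
    with half n 2≤n
       | ceilingLog (β ^ q) (n ^ q′)
           (≤-trans (s≤s 1≤b) (≤-trans (≤-reflexive (sym (^-identityʳ β))) (^-monoʳ-≤ β {1} {q} (s≤s z≤n))))
           (m^n>0 n {{n≢0}} q′)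
    where
    n≢0 : NonZero n
    n≢0 = >-nonZero (≤-trans (s≤s z≤n) 2≤n)
  ... | k , 2k≤n , n≤3k | s , v≤ , ≤v =
    s , v≤ , rich⇒wins 1≤b (*-monoʳ-≤ 2 {1} {q} (s≤s z≤n)) s k ⊤
      (≤-trans core (*-monoʳ-≤ (R ^ s) (≤-trans (m≤m+n k T) (m≤m+n (k + T) R))))
      (⊤-rich k 2k≤n)
    where
    open Multistage b R using (c)
    open Connectivity n b R T (≤-trans (s≤s z≤n) 2≤n) (power n<[1+y]^D)
    open ≤-Reasoning
    v = n ^ q′
    u = R ^ s
    c≡ : c ≡ suc (R * β)
    c≡ = trans (+-suc R (R * b)) (cong suc (sym (*-suc R b)))
    c^R≤ : c ^ R ≤ 2 * (R * β) ^ R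
    c^R≤ = begin
      c ^ R              ≡⟨ cong (_^ R) c≡ ⟩
      suc (R * β) ^ R    ≤⟨ [1+w]^i≤2w^i R (R * β) (s≤s z≤n) (≤-trans (≤-reflexive (*-comm 2 R)) (*-monoʳ-≤ R (s≤s 1≤b))) ⟩
      2 * (R * β) ^ R    ∎
    -- The R-th power of 1 + 1/(R β) is at most 2, and 2 ≤ β turns the resulting 2^s into β^s, which
    -- is at most β n.
    c^s^R≤ : (c ^ s) ^ R ≤ β ^ s * (u ^ R * (β ^ s) ^ R)
    c^s^R≤ = begin
      (c ^ s) ^ R                        ≡⟨ ^-swap c s R ⟩
      (c ^ R) ^ s                        ≤⟨ ^-monoˡ-≤ s c^R≤ ⟩
      (2 * (R * β) ^ R) ^ s              ≡⟨ ^-*-distribʳ 2 ((R * β) ^ R) s ⟩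
      2 ^ s * ((R * β) ^ R) ^ s          ≤⟨ *-monoˡ-≤ _ (^-monoˡ-≤ s (s≤s 1≤b)) ⟩
      β ^ s * ((R * β) ^ R) ^ s          ≡⟨ cong (β ^ s *_) (^-swap (R * β) R s) ⟩
      β ^ s * ((R * β) ^ s) ^ R          ≡⟨ cong (λ p → β ^ s * p ^ R) (^-*-distribʳ R β s) ⟩
      β ^ s * (u * β ^ s) ^ R            ≡⟨ cong (β ^ s *_) (^-*-distribʳ u (β ^ s) R) ⟩
      β ^ s * (u ^ R * (β ^ s) ^ R)      ∎
    β^s≤ : β ^ s ≤ β * n
    β^s≤ = ^-cancelˡ-≤ q (begin
      (β ^ s) ^ q     ≡⟨ ^-swap β s q ⟩
      (β ^ q) ^ s     ≤⟨ ≤v ⟩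
      β ^ q * v       ≤⟨ *-monoʳ-≤ (β ^ q) (m≤n*m v n {{>-nonZero (≤-trans (s≤s z≤n) 2≤n)}}) ⟩
      β ^ q * n ^ q   ≡⟨ ^-*-distribʳ β n q ⟨
      (β * n) ^ q     ∎)
    square : ∀ m → m ^ R ≡ (m ^ q) ^ 2
    square m = trans (cong (m ^_) (*-comm 2 q)) (sym (^-*-assoc m q 2))
    β^sR≤ : (β ^ s) ^ R ≤ β ^ R * v ^ 2
    β^sR≤ = begin
      (β ^ s) ^ R          ≡⟨ square (β ^ s) ⟩
      ((β ^ s) ^ q) ^ 2    ≡⟨ cong (_^ 2) (^-swap β s q) ⟩
      ((β ^ q) ^ s) ^ 2    ≤⟨ ^-monoˡ-≤ 2 ≤v ⟩
      (β ^ q * v) ^ 2      ≡⟨ ^-*-distribʳ (β ^ q) v 2 ⟩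
      (β ^ q) ^ 2 * v ^ 2  ≡⟨ cong (_* v ^ 2) (square β) ⟨
      β ^ R * v ^ 2        ∎
    β^[1+R]≤ : β * β ^ R ≤ (β * β) ^ R
    β^[1+R]≤ = ≤-trans
      (*-monoˡ-≤ (β ^ R) (≤-trans (≤-reflexive (sym (^-identityʳ β))) (^-monoʳ-≤ β {1} {R} (s≤s z≤n))))
      (≤-reflexive (sym (^-*-distribʳ β β R)))
    e₁ : ∀ β n u B V w → (β * n) * (u * (B * V)) * w ≡ u * ((β * B) * w * (n * V))
    e₁ = solve-∀
    e₂ : ∀ n v → n * (n * (v * (v * 1))) ≡ (n * v) * ((n * v) * 1)
    e₂ = solve-∀
    e₃ : ∀ c W → 3 * (c * W) ≡ c * (3 * W)
    e₃ = solve-∀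
    e₄ : ∀ u k → u * (3 * k) ≡ 3 * (u * k)
    e₄ = solve-∀
    powered : (c ^ s * (3 * W)) ^ R ≤ (u * (3 * k)) ^ R
    powered = begin
      (c ^ s * (3 * W)) ^ R                               ≡⟨ ^-*-distribʳ (c ^ s) (3 * W) R ⟩
      (c ^ s) ^ R * (3 * W) ^ R                           ≤⟨ *-monoˡ-≤ ((3 * W) ^ R) (≤-trans c^s^R≤ (*-mono-≤ β^s≤ (*-monoʳ-≤ (u ^ R) β^sR≤))) ⟩
      (β * n) * (u ^ R * (β ^ R * v ^ 2)) * (3 * W) ^ R   ≡⟨ e₁ β n (u ^ R) (β ^ R) (v ^ 2) ((3 * W) ^ R) ⟩
      u ^ R * ((β * β ^ R) * (3 * W) ^ R * (n * v ^ 2))   ≤⟨ *-monoʳ-≤ (u ^ R) (*-monoˡ-≤ (n * v ^ 2) (≤-trans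
                                                               (*-monoˡ-≤ ((3 * W) ^ R) β^[1+R]≤)
                                                               (≤-trans (≤-reflexive (sym (^-*-distribʳ (β * β) (3 * W) R))) small))) ⟩
      u ^ R * (n * (n * v ^ 2))                           ≡⟨ cong (u ^ R *_) (trans (e₂ n v) (sym (square n))) ⟩
      u ^ R * n ^ R                                       ≤⟨ *-monoʳ-≤ (u ^ R) (^-monoˡ-≤ R n≤3k) ⟩
      u ^ R * (3 * k) ^ R                                 ≡⟨ ^-*-distribʳ u (3 * k) R ⟨
      (u * (3 * k)) ^ R                                   ∎
    core : c ^ s * W ≤ u * k
    core = *-cancelˡ-≤ 3 (begin
      3 * (c ^ s * W)   ≡⟨ e₃ (c ^ s) W ⟩
      c ^ s * (3 * W)   ≤⟨ ^-cancelˡ-≤ R powered ⟩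
      u * (3 * k)       ≡⟨ e₄ u k ⟩
      3 * (u * k)       ∎)

-- `K` and `Q` depend on `q′` only, and the condition on n has the shape in which subpolynomiality
-- delivers it, with constant 1/K and exponent 1/Q.
makerLasts : ∀ q′ → ∃[ K ] ∃[ Q ] 0 < K × 0 < Q ×
  (∀ n b → 1 ≤ b → 2 ≤ n → (K * b) ^ Q ≤ n → ∃[ s ] n ^ q′ ≤ (suc b ^ suc q′) ^ s × MakerEnsures (𝓒 n) b s)
makerLasts q′ = 12 * (1 + R + 4 * R * R * (D + 3)) , 8 * R , s≤s z≤n , s≤s z≤n , lasts
  where
  R = 2 * suc q′
  D = 2 * R
  lasts : ∀ n b → 1 ≤ b → 2 ≤ n → (12 * (1 + R + 4 * R * R * (D + 3)) * b) ^ (8 * R) ≤ n →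
          ∃[ s ] n ^ q′ ≤ (suc b ^ suc q′) ^ s × MakerEnsures (𝓒 n) b s
  lasts n b 1≤b 2≤n K*b≤ =
    let y , 1≤y , y^D≤n , n<[1+y]^D = integerRoot D n (≤-trans (s≤s z≤n) 2≤n)
        s , n^q′≤ , wins = manyStages n b y q′ 1≤b 2≤n 1≤y n<[1+y]^D
                             (smallOverhead n b y q′ 1≤b 2≤n 1≤y y^D≤n K*b≤)
    in s , n^q′≤ , wins⇒ensures n b s wins

-- τ is to be a total function, although Maker can survive forever on some of the smallest graphs;
-- below 3 the value 0 is a placeholder.
thresholdFrom3 : ∀ (b : ℕ → ℕ) → (∀ n → 1 ≤ b n) → ∀ n → ∃[ t ] (3 ≤ n → IsThreshold (𝓒 n) (b n) t)
thresholdFrom3 b 1≤b n = decide (3 ≤? n)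
  where
  decide : Dec (3 ≤ n) → ∃[ t ] (3 ≤ n → IsThreshold (𝓒 n) (b n) t)
  decide (no  3≰n) = 0 , λ 3≤n → contradiction 3≤n 3≰n
  decide (yes 3≤n) = map₂ const (threshold n (b n) (1≤b n) 3≤n)

-- Comparison of the threshold with the logarithm

module _ (b : ℕ → ℕ) (1≤b : ∀ n → 1 ≤ b n) (τ : ℕ → ℕ)
         (isThreshold : ∀ n → 3 ≤ n → IsThreshold (𝓒 n) (b n) (τ n)) where

  open ≤-Reasoning

  -- As ε = p / q is at least 1 / q, there is a spare factor n, and it swallows 6^q.
  threshold-upper : ∀ n p q → 0 < p → 3 ≤ n → 6 ^ q ≤ n → suc (b n) ^ (τ n * q) ≤ n ^ (q + p)
  threshold-upper n p q 0<p 3≤n 6^q≤n = begin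
    suc (b n) ^ (τ n * q)     ≡⟨ ^-*-assoc (suc (b n)) (τ n) q ⟨
    (suc (b n) ^ τ n) ^ q     ≤⟨ ^-monoˡ-≤ q (ensures⇒small n (b n) 3≤n (τ n) (proj₁ (isThreshold n 3≤n))) ⟩
    (6 * n) ^ q               ≡⟨ ^-*-distribʳ 6 n q ⟩
    6 ^ q * n ^ q             ≤⟨ *-monoˡ-≤ (n ^ q) 6^q≤n ⟩
    n ^ suc q                 ≤⟨ ^-monoʳ-≤ n {{>-nonZero (≤-trans (s≤s z≤n) 3≤n)}} (≤-trans (≤-reflexive (sym (+-comm q 1))) (+-monoʳ-≤ q 0<p)) ⟩
    n ^ (q + p)               ∎

  threshold-lower : ∀ n p q′ s → 0 < p → 3 ≤ n → n ^ q′ ≤ (suc (b n) ^ suc q′) ^ s → MakerEnsures (𝓒 n) (b n) s →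
          n ^ (suc q′ ∸ p) ≤ suc (b n) ^ (τ n * suc q′)
  threshold-lower n p q′ s 0<p 3≤n n^q′≤ ensures = begin
    n ^ (suc q′ ∸ p)               ≤⟨ ^-monoʳ-≤ n {{>-nonZero (≤-trans (s≤s z≤n) 3≤n)}} (∸-monoʳ-≤ (suc q′) 0<p) ⟩
    n ^ q′                         ≤⟨ n^q′≤ ⟩
    (suc (b n) ^ suc q′) ^ s       ≤⟨ ^-monoʳ-≤ (suc (b n) ^ suc q′) {{m^n≢0 (suc (b n)) (suc q′)}} (proj₂ (isThreshold n 3≤n) s ensures) ⟩
    (suc (b n) ^ suc q′) ^ τ n     ≡⟨ ^-swap (suc (b n)) (suc q′) (τ n) ⟩
    (suc (b n) ^ τ n) ^ suc q′     ≡⟨ ^-*-assoc (suc (b n)) (τ n) (suc q′) ⟩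
    suc (b n) ^ (τ n * suc q′)     ∎

  asymptotics : Subpolynomial b → τ ≈[1+o[1]]log[ (λ n → b n + 1) ]
  asymptotics subpolynomial p zero 0<p ()
  asymptotics subpolynomial p q@(suc q′) 0<p p<q = eventually (makerLasts q′)
    where
    MakerLasts : ℕ → ℕ → Set
    MakerLasts K Q = 0 < K × 0 < Q × (∀ n b → 1 ≤ b → 2 ≤ n → (K * b) ^ Q ≤ n →
      ∃[ s ] n ^ q′ ≤ (suc b ^ q) ^ s × MakerEnsures (𝓒 n) b s)
    Bounds : ℕ → Set
    Bounds n = (b n + 1) ^ (τ n * q) ≤ n ^ (q + p) × n ^ (q ∸ p) ≤ (b n + 1) ^ (τ n * q)
    eventually : (∃[ K ] ∃[ Q ] MakerLasts K Q) → Eventually Bounds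
    eventually (K , Q , 0<K , 0<Q , lasts) with subpolynomial 1 Q (s≤s z≤n) 0<Q K 0<K
    ... | n₀ , small = 3 + 6 ^ q + n₀ , bounds
      where
      bounds : ∀ n → 3 + 6 ^ q + n₀ ≤ n → Bounds n
      bounds n large =
        subst (λ β → β ^ (τ n * q) ≤ n ^ (q + p) × n ^ (q ∸ p) ≤ β ^ (τ n * q)) (+-comm 1 (b n))
          (threshold-upper n p q 0<p 3≤n 6^q≤n , threshold-lower n p q′ s 0<p 3≤n n^q′≤ ensures)
        where
        3≤n : 3 ≤ n
        3≤n = ≤-trans (≤-trans (m≤m+n 3 (6 ^ q)) (m≤m+n (3 + 6 ^ q) n₀)) large
        6^q≤n : 6 ^ q ≤ n
        6^q≤n = ≤-trans (≤-trans (m≤n+m (6 ^ q) 3) (m≤m+n (3 + 6 ^ q) n₀)) large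
        maker : ∃[ s ] n ^ q′ ≤ (suc (b n) ^ q) ^ s × MakerEnsures (𝓒 n) (b n) s
        maker = lasts n (b n) (1≤b n) (≤-trans (s≤s (s≤s z≤n)) 3≤n)
          (≤-trans (small n (≤-trans (m≤n+m n₀ (3 + 6 ^ q)) large)) (≤-reflexive (^-identityʳ n)))
        s = proj₁ maker
        n^q′≤ = proj₁ (proj₂ maker)
        ensures = proj₂ (proj₂ maker)

corollary1p2 : (b : ℕ → ℕ) → (∀ n → 1 ≤ b n) → Subpolynomial b →
    ∃[ τ ] (∀ n → 3 ≤ n → IsThreshold (𝓒 n) (b n) (τ n)) × τ ≈[1+o[1]]log[ (λ n → b n + 1) ]
corollary1p2 b 1≤b subpolynomial = τ , isThreshold , asymptotics b 1≤b τ isThreshold subpolynomial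
  where
  τ : ℕ → ℕ
  τ n = proj₁ (thresholdFrom3 b 1≤b n)
  isThreshold : ∀ n → 3 ≤ n → IsThreshold (𝓒 n) (b n) (τ n)
  isThreshold n = proj₂ (thresholdFrom3 b 1≤b n)
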